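{- There is a polynomial-time $8$-approximation algorithm for the Demand Pair Selection Problem (DPSP).
   Context: In DPSP one is given two disjoint directed paths $\sigma$ and $\sigma'$, a collection $\mathcal{M}=\{(s_1,t_1),\dots,(s_k,t_k)\}$ of demand pairs with all $s_i\in V(\sigma)$ and all $t_i\in V(\sigma')$ (a vertex may participate in several pairs), and a set $\mathcal{K}$ of constraints. For $v,v'$ on the same path, $v\prec v'$ means $v$ lies strictly before $v'$ on that path, and $v\preceq v'$ means $v\prec v'$ or $v=v'$; for $a\preceq b$ on a path, $(a,b)$ denotes the subpath from $a$ to $b$ inclusive. Two pairs $(a,b),(a',b')$ with $a,a'\in\sigma$, $b,b'\in\sigma'$ cross if $a=a'$, or $b=b'$, or ($a\prec a'$ and $b'\prec b$), or ($a'\prec a$ and $b\prec b'$); a subset of $\mathcal{M}$ is non-crossing if no two distinct pairs in it cross. Each constraint is a quadruple $(i,a,b,w)$ with $i\in\{1,2,3,4\}$, $a,b\in V(\sigma)\cup V(\sigma')$, and integer $1\leq w\leq|\mathcal{M}|$. Type 1: $a,b\in V(\sigma)$, $a\prec b$; a set $\mathcal{M}'$ satisfies it if at most $w$ source vertices of pairs of $\mathcal{M}'$ lie on $(a,b)$. Type 2: $a,b\in V(\sigma')$, $a\prec b$; satisfied if at most $w$ destination vertices of pairs of $\mathcal{M}'$ lie on $(a,b)$. Type 3: $a\in V(\sigma)$, $b\in V(\sigma')$; satisfied if at most $w$ pairs $(s,t)\in\mathcal{M}'$ have $s\preceq a$ and $b\preceq t$. Type 4: $a\in V(\sigma)$,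 $b\in V(\sigma')$; satisfied if at most $w$ pairs $(s,t)\in\mathcal{M}'$ have $a\preceq s$ and $t\preceq b$. The goal is to find a maximum-cardinality non-crossing subset $\mathcal{M}'\subseteq\mathcal{M}$ satisfying all constraints of $\mathcal{K}$. An $8$-approximation returns a feasible solution of cardinality at least $1/8$ of the optimum. -}

module Defs where

open import Data.Fin using (Fin) renaming (_<_ to _≺_; _≤_ to _≼_; _≤?_ to _≼?_; toℕ to position)
open import Data.Fin.Properties using () renaming (_≟_ to _≟ᶠ_)
open import Data.List using (List; []; _∷_; length; map; filter; allFin)
open import Data.List.Membership.Propositional using (_∈_)
open import Data.List.Relation.Binary.Subset.Propositional using (_⊆_)
open import Data.List.Relation.Unary.All using (All)
open import Data.List.Relation.Unary.Unique.Propositional using (Unique)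
import Data.List.Membership.DecPropositional as DecMembership
open import Data.Nat using (ℕ; zero; suc; _+_; _*_; _^_; _≤_)
open import Data.Product using (_×_; _,_; proj₁; proj₂; ∃-syntax)
open import Data.Sum using (_⊎_)
open import Data.Vec using (Vec; []; _∷_; lookup)
open import Relation.Binary.PropositionalEquality using (_≡_; _≢_)
open import Relation.Nullary using (¬_)
open import Relation.Nullary.Decidable using (_×-dec_)

------------------------------------------------------------------------
-- Machine model: first-order, call-by-value pure LISP.  Every evaluation
-- rule costs one step.  Values are immutable, so an implementation passes
-- pointers and shares subtrees; each rule is then O(1) work for a fixed
-- program, and polynomial time here agrees with polynomial time on Turing
-- machines (see N. D. Jones, "Computability and Complexity from a
-- Programming Perspective").

data Tree : Set where
  nil  : Tree
  cons : Tree → Tree → Tree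

size : Tree → ℕ
size nil        = 1
size (cons l r) = 1 + size l + size r

-- Expressions over function symbols Fin F of the given arities, with k free
-- variables (de Bruijn indices).
data Exp {F : ℕ} (arity : Fin F → ℕ) (k : ℕ) : Set where
  var   : Fin k → Exp arity k
  nil   : Exp arity k
  cons  : Exp arity k → Exp arity k → Exp arity k
  -- The second branch binds the head (index 0) and the tail (index 1).
  match : Exp arity k → Exp arity k → Exp arity (suc (suc k)) → Exp arity k
  bind  : Exp arity k → Exp arity (suc k) → Exp arity k
  call  : (f : Fin F) → Vec (Exp arity k) (arity f) → Exp arity k

record Program : Set where
  field
    {functions} : ℕ
    arity       : Fin functions → ℕ
    body        : (f : Fin functions) → Exp arity (arity f)
    main        : Exp arity 1

module Semantics {F : ℕ} {arity : Fin F → ℕ}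
                 (body : (f : Fin F) → Exp arity (arity f)) where

  infix 4 _⊢_⇓_[_] _⊢*_⇓_[_]

  -- ρ ⊢ e ⇓ v [ t ]: in environment ρ, e evaluates to v in t steps.
  -- The rules are syntax-directed, so v and t are determined by ρ and e.
  mutual
    data _⊢_⇓_[_] {k : ℕ} (ρ : Vec Tree k) : Exp arity k → Tree → ℕ → Set where
      var        : ∀ {i} → ρ ⊢ var i ⇓ lookup ρ i [ 1 ]
      nil        : ρ ⊢ nil ⇓ nil [ 1 ]
      cons       : ∀ {e₁ e₂ v₁ v₂ t₁ t₂} →
                   ρ ⊢ e₁ ⇓ v₁ [ t₁ ] → ρ ⊢ e₂ ⇓ v₂ [ t₂ ] →
                   ρ ⊢ cons e₁ e₂ ⇓ cons v₁ v₂ [ 1 + t₁ + t₂ ]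
      match-nil  : ∀ {e e₁ e₂ v t t₁} →
                   ρ ⊢ e ⇓ nil [ t ] → ρ ⊢ e₁ ⇓ v [ t₁ ] →
                   ρ ⊢ match e e₁ e₂ ⇓ v [ 1 + t + t₁ ]
      match-cons : ∀ {e e₁ e₂ l r v t t₂} →
                   ρ ⊢ e ⇓ cons l r [ t ] → (l ∷ r ∷ ρ) ⊢ e₂ ⇓ v [ t₂ ] →
                   ρ ⊢ match e e₁ e₂ ⇓ v [ 1 + t + t₂ ]
      bind       : ∀ {e₁ e₂ v₁ v₂ t₁ t₂} →
                   ρ ⊢ e₁ ⇓ v₁ [ t₁ ] → (v₁ ∷ ρ) ⊢ e₂ ⇓ v₂ [ t₂ ] →
                   ρ ⊢ bind e₁ e₂ ⇓ v₂ [ 1 + t₁ + t₂ ]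
      call       : ∀ {f es vs v t₁ t₂} →
                   ρ ⊢* es ⇓ vs [ t₁ ] → vs ⊢ body f ⇓ v [ t₂ ] →
                   ρ ⊢ call f es ⇓ v [ 1 + t₁ + t₂ ]

    data _⊢*_⇓_[_] {k : ℕ} (ρ : Vec Tree k) :
                   ∀ {n} → Vec (Exp arity k) n → Vec Tree n → ℕ → Set where
      []  : ρ ⊢* [] ⇓ [] [ 0 ]
      _∷_ : ∀ {n e v t₁ t₂} {es : Vec (Exp arity k) n} {vs : Vec Tree n} →
            ρ ⊢ e ⇓ v [ t₁ ] → ρ ⊢* es ⇓ vs [ t₂ ] →
            ρ ⊢* (e ∷ es) ⇓ (v ∷ vs) [ t₁ + t₂ ]

-- On the given input, the program halts with the given output after exactly
-- t steps.
Run : Program → (input output : Tree) (t : ℕ) → Set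
Run p input output t = (input ∷ []) ⊢ main ⇓ output [ t ]
  where
  open Program p
  open Semantics body

------------------------------------------------------------------------
-- The Demand Pair Selection Problem.  The vertices of σ and σ′, in path
-- order, are Fin n and Fin n′; a pair in Fin n × Fin n′ is a (source,
-- destination) pair.

Pair : ℕ → ℕ → Set
Pair n n′ = Fin n × Fin n′

data Constraint (n n′ : ℕ) : Set where
  type₁ : (a b : Fin n) (w : ℕ) → Constraint n n′
  type₂ : (a b : Fin n′) (w : ℕ) → Constraint n n′
  type₃ : (a : Fin n) (b : Fin n′) (w : ℕ) → Constraint n n′
  type₄ : (a : Fin n) (b : Fin n′) (w : ℕ) → Constraint n n′

-- The requirements on a constraint when there are k demand pairs.
Admissible : ∀ {n n′} → ℕ → Constraint n n′ → Set
Admissible k (type₁ a b w) = a ≺ b × 1 ≤ w × w ≤ k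
Admissible k (type₂ a b w) = a ≺ b × 1 ≤ w × w ≤ k
Admissible k (type₃ a b w) = 1 ≤ w × w ≤ k
Admissible k (type₄ a b w) = 1 ≤ w × w ≤ k

record Instance : Set where
  field
    n n′               : ℕ
    demands            : List (Pair n n′)
    demands-unique     : Unique demands
    constraints        : List (Constraint n n′)
    constraints-unique : Unique constraints
    admissible         : All (Admissible (length demands)) constraints

Cross : ∀ {n n′} → Pair n n′ → Pair n n′ → Set
Cross (a , b) (a′ , b′) =
  a ≡ a′ ⊎ b ≡ b′ ⊎ (a ≺ a′ × b′ ≺ b) ⊎ (a′ ≺ a × b ≺ b′)

NonCrossing : ∀ {n n′} → List (Pair n n′) → Set
NonCrossing M = ∀ {p q} → p ∈ M → q ∈ M → p ≢ q → ¬ Cross p q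

-- The number of distinct vertices of the subpath from a to b that occur in vs.
countOn : ∀ {n} → (a b : Fin n) → List (Fin n) → ℕ
countOn {n} a b vs =
  length (filter (λ v → (a ≼? v) ×-dec (v ≼? b) ×-dec (v ∈? vs)) (allFin n))
  where open DecMembership (_≟ᶠ_ {n}) using (_∈?_)

Satisfies : ∀ {n n′} → List (Pair n n′) → Constraint n n′ → Set
Satisfies M (type₁ a b w) = countOn a b (map proj₁ M) ≤ w
Satisfies M (type₂ a b w) = countOn a b (map proj₂ M) ≤ w
Satisfies M (type₃ a b w) =
  length (filter (λ p → (proj₁ p ≼? a) ×-dec (b ≼? proj₂ p)) M) ≤ w
Satisfies M (type₄ a b w) =
  length (filter (λ p → (a ≼? proj₁ p) ×-dec (proj₂ p ≼? b)) M) ≤ w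

module _ (I : Instance) where
  open Instance I

  -- A duplicate-free list represents a set; its length is the cardinality.
  record Feasible (M : List (Pair n n′)) : Set where
    field
      unique      : Unique M
      subset      : M ⊆ demands
      nonCrossing : NonCrossing M
      satisfies   : All (Satisfies M) constraints

  Optimal : List (Pair n n′) → Set
  Optimal M = Feasible M × (∀ N → Feasible N → length N ≤ length M)

------------------------------------------------------------------------
-- Encodings.  Numbers are in unary: the vertices are part of the input and
-- w ≤ |M|, so this is polynomially equivalent to binary.

encodeℕ : ℕ → Tree
encodeℕ zero    = nil
encodeℕ (suc m) = cons nil (encodeℕ m)

encodeFin : ∀ {m} → Fin m → Tree
encodeFin v = encodeℕ (position v)

encodeList : {A : Set} → (A → Tree) → List A → Tree
encodeList enc []       = nil
encodeList enc (x ∷ xs) = cons (enc x) (encodeList enc xs)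

encodePair : ∀ {n n′} → Pair n n′ → Tree
encodePair (s , t) = cons (encodeFin s) (encodeFin t)

encodeQuadruple : ℕ → Tree → Tree → ℕ → Tree
encodeQuadruple i a b w = cons (encodeℕ i) (cons a (cons b (encodeℕ w)))

encodeConstraint : ∀ {n n′} → Constraint n n′ → Tree
encodeConstraint (type₁ a b w) = encodeQuadruple 1 (encodeFin a) (encodeFin b) w
encodeConstraint (type₂ a b w) = encodeQuadruple 2 (encodeFin a) (encodeFin b) w
encodeConstraint (type₃ a b w) = encodeQuadruple 3 (encodeFin a) (encodeFin b) w
encodeConstraint (type₄ a b w) = encodeQuadruple 4 (encodeFin a) (encodeFin b) w

encodeInstance : Instance → Tree
encodeInstance I =
  cons (encodeℕ n)
    (cons (encodeℕ n′)
      (cons (encodeList encodePair demands)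
            (encodeList encodeConstraint constraints)))
  where open Instance I

encodeSolution : ∀ {n n′} → List (Pair n n′) → Tree
encodeSolution = encodeList encodePair

------------------------------------------------------------------------

-- Since size ≥ 1, bounds c * size ^ d dominate all polynomials in size.
PolynomialTime : Program → Set
PolynomialTime p =
  ∃[ c ] ∃[ d ] ((I : Instance) →
    ∃[ out ] ∃[ t ] (Run p (encodeInstance I) out t
                     × t ≤ c * size (encodeInstance I) ^ d))

IsApproximation : ℕ → Program → Set
IsApproximation α p =
  (I : Instance) →
    ∃[ M ] ∃[ t ] (Run p (encodeInstance I) (encodeSolution M) t
                   × Feasible I M
                   × (∀ N → Optimal I N → length N ≤ α * length M))

{-# OPTIONS --safe #-}
module Submission where

-- A non-crossing set is a chain p₁ ⋖ p₂ ⋖ …, increasing on both paths, and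
-- the set of pairs counted by a constraint is convex.  So a chain satisfies a
-- constraint of weight w iff no w + 1 consecutive elements have both of their
-- ends counted by it.
--
-- The algorithm imposes this only on dyadic blocks: a block of level j joins
-- two consecutive blocks of level j - 1, and no constraint of weight < 2 ^ j
-- counts both of its ends.  For each level, dynamic programming finds a block
-- for every pair of ends that admits one.  If 2 ^ j elements is the largest
-- size found, then an optimal solution has fewer than 2 ^ (j + 1) elements,
-- since its first 2 ^ (j + 1) elements would form a block.  Conversely, take
-- every fourth element of a block.  For a constraint of weight w choose k with
-- 2 ^ (k + 1) - 1 ≤ w < 2 ^ (k + 2).  No aligned block of level k + 2 is
-- counted entirely, so the constraint meets at most two of them, and counts
-- at most 2 ^ (k + 1) - 1 of the remaining elements.  Rounding to a power of
-- two costs a factor 2 and thinning a factor 4.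

open import Defs
open import Algebra.Properties.CommutativeSemigroup using (interchange)
open import Data.Bool using (Bool; true; false; not; _∧_; if_then_else_)
open import Data.Fin using (Fin; zero; suc; #_) renaming (_<_ to _≺_; _≤_ to _≼_; _≤?_ to _≼?_; _<?_ to _≺?_; toℕ to position)
open import Data.Fin.Properties using (toℕ-injective; toℕ<n) renaming (_≟_ to _≟ᶠ_; <-cmp to ≺-cmp; <⇒≢ to ≺⇒≢)
open import Data.List using (List; []; _∷_; _++_; length; map; filter; allFin; take; drop; cartesianProduct)
import Data.List.Membership.DecPropositional as DecMembership
open import Data.List.Membership.Propositional using (_∈_; find; lose)
open import Data.List.Membership.Propositional.Properties using (∈-∃++; ∈-++⁺ˡ; ∈-++⁺ʳ; ∈-++⁻; ∈-map⁺; ∈-map⁻; ∈-filter⁺; ∈-filter⁻; ∈-allFin; ∈-cartesianProduct⁺; ∈-cartesianProduct⁻)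
open import Data.List.Properties using (length-++; length-map; length-take; length-drop; take++drop≡id; length-tabulate; length-filter; filter-++; filter-none; filter-notAll)
open import Data.List.Relation.Binary.Subset.Propositional using (_⊆_)
open import Data.List.Relation.Binary.Subset.Propositional.Properties using () renaming (map⁺ to ⊆-map⁺)
open import Data.List.Relation.Unary.All as All using (All; []; _∷_)
import Data.List.Relation.Unary.All.Properties as All
open import Data.List.Relation.Unary.AllPairs as AllPairs using (AllPairs; []; _∷_)
import Data.List.Relation.Unary.AllPairs.Properties as AllPairs
open import Data.List.Relation.Unary.Any using (here; there; any?)
open import Data.List.Relation.Unary.Unique.Propositional using (Unique)
open import Data.List.Relation.Unary.Unique.Propositional.Properties using (allFin⁺)
open import Data.Maybe using (Maybe; just; nothing; maybe′)
open import Data.Nat using (ℕ; zero; suc; _+_; _*_; _^_; _∸_; _⊓_; _≤_; _<_; _≤ᵇ_; _<ᵇ_; _<?_; z≤n; s≤s; s≤s⁻¹; >-nonZero)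
open import Data.Nat.Properties
open import Data.Product using (_×_; _,_; proj₁; proj₂; ∃-syntax; uncurry)
open import Data.Sum using (_⊎_; inj₁; inj₂; [_,_]′)
open import Data.Vec using (Vec; []; _∷_; lookup)
open import Function using (_∘_; id)
open import Relation.Binary.Definitions using (tri<; tri≈; tri>)
open import Relation.Binary.PropositionalEquality using (_≡_; _≢_; refl; sym; trans; cong; cong₂; subst)
open import Relation.Nullary using (¬_; Dec; yes; no; contradiction; does)
open import Relation.Nullary.Decidable using (True; _×-dec_; ¬?; map′)

private
  variable
    A B : Set
    n n′ : ℕ

-- Cardinality of duplicate-free lists

unique⇒length-⊆ : {xs ys : List A} → Unique xs → xs ⊆ ys → length xs ≤ length ys
unique⇒length-⊆ {xs = []}     _        _   = z≤n
unique⇒length-⊆ {xs = x ∷ xs} (x∉ ∷ u) sub with ∈-∃++ (sub (here refl))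
... | as , bs , refl = begin
  suc (length xs)               ≤⟨ s≤s (unique⇒length-⊆ u sub′) ⟩
  suc (length (as ++ bs))       ≡⟨ cong suc (length-++ as) ⟩
  suc (length as + length bs)   ≡⟨ +-suc (length as) (length bs) ⟨
  length as + suc (length bs)   ≡⟨ length-++ as ⟨
  length (as ++ x ∷ bs)         ∎
  where
  open ≤-Reasoning
  sub′ : xs ⊆ as ++ bs
  sub′ y∈ with ∈-++⁻ as (sub (there y∈))
  ... | inj₁ y∈as         = ∈-++⁺ˡ y∈as
  ... | inj₂ (here refl)  = contradiction refl (All.lookup x∉ y∈)
  ... | inj₂ (there y∈bs) = ∈-++⁺ʳ as y∈bs

-- Chains

infix 4 _⋖_ _⊑_

_⋖_ _⊑_ : Pair n n′ → Pair n n′ → Set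
p ⋖ q = proj₁ p ≺ proj₁ q × proj₂ p ≺ proj₂ q
p ⊑ q = proj₁ p ≼ proj₁ q × proj₂ p ≼ proj₂ q

⋖-trans : {p q r : Pair n n′} → p ⋖ q → q ⋖ r → p ⋖ r
⋖-trans (a , b) (c , d) = <-trans a c , <-trans b d

⋖⇒⊑ : {p q : Pair n n′} → p ⋖ q → p ⊑ q
⋖⇒⊑ (a , b) = <⇒≤ a , <⇒≤ b

⊑-refl : {p : Pair n n′} → p ⊑ p
⊑-refl = ≤-refl , ≤-refl

⊑-trans : {p q r : Pair n n′} → p ⊑ q → q ⊑ r → p ⊑ r
⊑-trans (a , b) (c , d) = ≤-trans a c , ≤-trans b d

⊑-⋖-trans : {p q r : Pair n n′} → p ⊑ q → q ⋖ r → p ⋖ r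
⊑-⋖-trans (a , b) (c , d) = ≤-<-trans a c , ≤-<-trans b d

⋖-⊑-trans : {p q r : Pair n n′} → p ⋖ q → q ⊑ r → p ⋖ r
⋖-⊑-trans (a , b) (c , d) = <-≤-trans a c , <-≤-trans b d

Chain : List (Pair n n′) → Set
Chain = AllPairs _⋖_

chain⇒unique₁ : {c : List (Pair n n′)} → Chain c → Unique (map proj₁ c)
chain⇒unique₁ = AllPairs.map⁺ ∘ AllPairs.map (≺⇒≢ ∘ proj₁)

chain⇒unique₂ : {c : List (Pair n n′)} → Chain c → Unique (map proj₂ c)
chain⇒unique₂ = AllPairs.map⁺ ∘ AllPairs.map (≺⇒≢ ∘ proj₂)

chain⇒unique : {c : List (Pair n n′)} → Chain c → Unique c
chain⇒unique = AllPairs.map (λ p⋖q p≡q → ≺⇒≢ (proj₁ p⋖q) (cong proj₁ p≡q))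

-- Sources along a chain are distinct vertices of the first path. This limits both the number of
-- doubling levels and the length of any stored chain.
chain-length≤ : {c : List (Pair n n′)} → Chain c → length c ≤ n
chain-length≤ {n} {c = c} ch = begin
  length c               ≡⟨ length-map proj₁ c ⟨
  length (map proj₁ c)   ≤⟨ unique⇒length-⊆ (chain⇒unique₁ ch) (λ _ → ∈-allFin _) ⟩
  length (allFin n)      ≡⟨ length-tabulate {n = n} id ⟩
  n                      ∎
  where open ≤-Reasoning

⋖⇒¬cross : {p q : Pair n n′} → p ⋖ q → ¬ Cross p q
⋖⇒¬cross (a , b) (inj₁ e)                        = ≺⇒≢ a e
⋖⇒¬cross (a , b) (inj₂ (inj₁ e))                 = ≺⇒≢ b e
⋖⇒¬cross (a , b) (inj₂ (inj₂ (inj₁ (_ , b>))))   = <-asym b b>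
⋖⇒¬cross (a , b) (inj₂ (inj₂ (inj₂ (a> , _))))   = <-asym a a>

⋗⇒¬cross : {p q : Pair n n′} → q ⋖ p → ¬ Cross p q
⋗⇒¬cross (a , b) (inj₁ e)                        = ≺⇒≢ a (sym e)
⋗⇒¬cross (a , b) (inj₂ (inj₁ e))                 = ≺⇒≢ b (sym e)
⋗⇒¬cross (a , b) (inj₂ (inj₂ (inj₁ (a> , _))))   = <-asym a a>
⋗⇒¬cross (a , b) (inj₂ (inj₂ (inj₂ (_ , b>))))   = <-asym b b>

chain⇒comparable : {c : List (Pair n n′)} → Chain c → ∀ {p q} →
                   p ∈ c → q ∈ c → p ≢ q → p ⋖ q ⊎ q ⋖ p
chain⇒comparable (_  ∷ _)  (here refl) (here refl) p≢q = contradiction refl p≢q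
chain⇒comparable (p⋖ ∷ _)  (here refl) (there q∈)  _   = inj₁ (All.lookup p⋖ q∈)
chain⇒comparable (q⋖ ∷ _)  (there p∈)  (here refl) _   = inj₂ (All.lookup q⋖ p∈)
chain⇒comparable (_  ∷ ch) (there p∈)  (there q∈)  p≢q = chain⇒comparable ch p∈ q∈ p≢q

chain-++⁻ : ∀ c {d : List (Pair n n′)} → Chain (c ++ d) →
            Chain c × Chain d × (∀ {x y} → x ∈ c → y ∈ d → x ⋖ y)
chain-++⁻ []      ch = [] , ch , λ ()
chain-++⁻ (x ∷ c) (x⋖ ∷ ch) with chain-++⁻ c ch
... | chc , chd , sep = All.++⁻ˡ c x⋖ ∷ chc , chd , λ where
  (here refl) y∈ → All.lookup (All.++⁻ʳ c x⋖) y∈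
  (there x∈)  y∈ → sep x∈ y∈

chain⇒nonCrossing : {c : List (Pair n n′)} → Chain c → NonCrossing c
chain⇒nonCrossing ch p∈ q∈ p≢q = [ ⋖⇒¬cross , ⋗⇒¬cross ]′ (chain⇒comparable ch p∈ q∈ p≢q)

¬cross⇒comparable : {p q : Pair n n′} → ¬ Cross p q → p ⋖ q ⊎ q ⋖ p
¬cross⇒comparable {p = s , t} {s′ , t′} ¬x with ≺-cmp s s′ | ≺-cmp t t′
... | tri≈ _ e _ | _          = contradiction (inj₁ e) ¬x
... | _          | tri≈ _ e _ = contradiction (inj₂ (inj₁ e)) ¬x
... | tri< a _ _ | tri< b _ _ = inj₁ (a , b)
... | tri> _ _ a | tri> _ _ b = inj₂ (a , b)
... | tri< a _ _ | tri> _ _ b = contradiction (inj₂ (inj₂ (inj₁ (a , b)))) ¬x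
... | tri> _ _ a | tri< b _ _ = contradiction (inj₂ (inj₂ (inj₂ (a , b)))) ¬x

insert-chain : ∀ (x : Pair n n′) {c} → Chain c → (∀ {y} → y ∈ c → x ⋖ y ⊎ y ⋖ x) →
               ∃[ d ] (Chain d × d ⊆ x ∷ c × length d ≡ suc (length c))
insert-chain x [] _ = x ∷ [] , [] ∷ [] , id , refl
insert-chain x {y ∷ ys} (y⋖ ∷ ch) cmp with cmp (here refl)
... | inj₁ x⋖y = x ∷ y ∷ ys , (x⋖y ∷ All.map (⋖-trans x⋖y) y⋖) ∷ y⋖ ∷ ch , id , refl
... | inj₂ y⋖x with insert-chain x ch (cmp ∘ there)
...   | d , chd , sub , len = y ∷ d , All.tabulate y⋖d ∷ chd , sub′ , cong suc len
  where
  y⋖d : ∀ {z} → z ∈ d → y ⋖ z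
  y⋖d z∈ with sub z∈
  ... | here refl = y⋖x
  ... | there z∈c = All.lookup y⋖ z∈c
  sub′ : y ∷ d ⊆ x ∷ y ∷ ys
  sub′ (here refl) = there (here refl)
  sub′ (there z∈) with sub z∈
  ... | here refl = here refl
  ... | there z∈c = there (there z∈c)

-- Insertion sort: non-crossing makes any two distinct pairs comparable under `⋖`, so each pair
-- finds its place in the sorted rest. Inclusion together with equal length stands in for a
-- permutation.
nonCrossing⇒chain : ∀ {N : List (Pair n n′)} → Unique N → NonCrossing N →
                    ∃[ c ] (Chain c × c ⊆ N × length c ≡ length N)
nonCrossing⇒chain [] _ = [] , [] , id , refl
nonCrossing⇒chain {N = x ∷ N} (x∉ ∷ u) nc
  with nonCrossing⇒chain u (λ p∈ q∈ → nc (there p∈) (there q∈))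
... | c , ch , sub , len
  with insert-chain x ch (λ y∈ → ¬cross⇒comparable (nc (here refl) (there (sub y∈)) (All.lookup x∉ (sub y∈))))
... | d , chd , subd , lend = d , chd , sub′ , trans lend (cong suc len)
  where
  sub′ : d ⊆ x ∷ N
  sub′ z∈ with subd z∈
  ... | here refl = here refl
  ... | there z∈c = there (sub z∈c)

-- Constraints

weight : Constraint n n′ → ℕ
weight (type₁ _ _ w) = w
weight (type₂ _ _ w) = w
weight (type₃ _ _ w) = w
weight (type₄ _ _ w) = w

-- Types 1 and 2 count vertices and types 3 and 4 count pairs; reading all four as regions of pairs
-- lets convexity and counting be argued once.
Inside : Constraint n n′ → Pair n n′ → Set
Inside (type₁ a b _) (s , t) = a ≼ s × s ≼ b
Inside (type₂ a b _) (s , t) = a ≼ t × t ≼ b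
Inside (type₃ a b _) (s , t) = s ≼ a × b ≼ t
Inside (type₄ a b _) (s , t) = a ≼ s × t ≼ b

inside? : (K : Constraint n n′) (p : Pair n n′) → Dec (Inside K p)
inside? (type₁ a b _) (s , t) = (a ≼? s) ×-dec (s ≼? b)
inside? (type₂ a b _) (s , t) = (a ≼? t) ×-dec (t ≼? b)
inside? (type₃ a b _) (s , t) = (s ≼? a) ×-dec (b ≼? t)
inside? (type₄ a b _) (s , t) = (a ≼? s) ×-dec (t ≼? b)

-- Each region is cut out by one lower and one upper bound on coordinates. The middle pair inherits
-- lower bounds from `x` and upper bounds from `z`, whichever path they concern.
inside-convex : ∀ (K : Constraint n n′) {x y z} → x ⊑ y → y ⊑ z →
                Inside K x → Inside K z → Inside K y
inside-convex (type₁ a b _) (xy , _) (yz , _) (ax , _) (_ , zb) = ≤-trans ax xy , ≤-trans yz zb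
inside-convex (type₂ a b _) (_ , xy) (_ , yz) (ax , _) (_ , zb) = ≤-trans ax xy , ≤-trans yz zb
inside-convex (type₃ a b _) (_ , xy) (yz , _) (_ , bx) (za , _) = ≤-trans yz za , ≤-trans bx xy
inside-convex (type₄ a b _) (xy , _) (_ , yz) (ax , _) (_ , zb) = ≤-trans ax xy , ≤-trans yz zb

countIn : Constraint n n′ → List (Pair n n′) → ℕ
countIn K M = length (filter (inside? K) M)

module _ {a b : Fin n} {vs : List (Fin n)} where
  open DecMembership (_≟ᶠ_ {n}) using (_∈?_)

  length≤countOn : ∀ {us} → Unique us → us ⊆ vs → All (λ v → a ≼ v × v ≼ b) us →
                   length us ≤ countOn a b vs
  length≤countOn u sub on = unique⇒length-⊆ u λ v∈ →
    ∈-filter⁺ (λ v → (a ≼? v) ×-dec (v ≼? b) ×-dec (v ∈? vs)) (∈-allFin _)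
      (proj₁ (All.lookup on v∈) , proj₂ (All.lookup on v∈) , sub v∈)

  countOn≤length : ∀ {us} → (∀ {v} → v ∈ vs → a ≼ v → v ≼ b → v ∈ us) → countOn a b vs ≤ length us
  countOn≤length sub = unique⇒length-⊆
    (AllPairs.filter⁺ (λ v → (a ≼? v) ×-dec (v ≼? b) ×-dec (v ∈? vs)) (allFin⁺ n)) λ v∈ →
      let (_ , av , vb , v∈vs) = ∈-filter⁻ (λ v → (a ≼? v) ×-dec (v ≼? b) ×-dec (v ∈? vs)) {xs = allFin n} v∈ in
      sub v∈vs av vb

module _ {M : List (Pair n n′)} where

  -- Types 1 and 2 bound the number of distinct vertices, but both projections are injective on a
  -- chain, so there the number of pairs is bounded as well.
  satisfies⇒length≤weight : ∀ K {c} → Chain c → c ⊆ M → All (Inside K) c → Satisfies M K →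
                            length c ≤ weight K
  satisfies⇒length≤weight (type₁ a b w) {c} ch sub ins sat = begin
    length c                       ≡⟨ length-map proj₁ c ⟨
    length (map proj₁ c)           ≤⟨ length≤countOn (chain⇒unique₁ ch) (⊆-map⁺ proj₁ sub) (All.map⁺ ins) ⟩
    countOn a b (map proj₁ M)      ≤⟨ sat ⟩
    w                              ∎
    where open ≤-Reasoning
  satisfies⇒length≤weight (type₂ a b w) {c} ch sub ins sat = begin
    length c                       ≡⟨ length-map proj₂ c ⟨
    length (map proj₂ c)           ≤⟨ length≤countOn (chain⇒unique₂ ch) (⊆-map⁺ proj₂ sub) (All.map⁺ ins) ⟩
    countOn a b (map proj₂ M)      ≤⟨ sat ⟩
    w                              ∎
    where open ≤-Reasoning
  satisfies⇒length≤weight K@(type₃ a b w) ch sub ins sat =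
    ≤-trans (unique⇒length-⊆ (chain⇒unique ch) (λ x∈ → ∈-filter⁺ (inside? K) (sub x∈) (All.lookup ins x∈))) sat
  satisfies⇒length≤weight K@(type₄ a b w) ch sub ins sat =
    ≤-trans (unique⇒length-⊆ (chain⇒unique ch) (λ x∈ → ∈-filter⁺ (inside? K) (sub x∈) (All.lookup ins x∈))) sat

  -- Every vertex counted by type 1 or 2 is an end of some inside pair, so counting pairs
  -- overestimates the number of vertices. For types 3 and 4 the two counts coincide.
  countIn≤weight⇒satisfies : ∀ K → countIn K M ≤ weight K → Satisfies M K
  countIn≤weight⇒satisfies K@(type₁ a b w) le = begin
    countOn a b (map proj₁ M)               ≤⟨ countOn≤length cover ⟩
    length (map proj₁ (filter (inside? K) M)) ≡⟨ length-map proj₁ (filter (inside? K) M) ⟩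
    countIn K M                             ≤⟨ le ⟩
    w                                       ∎
    where
    open ≤-Reasoning
    cover : ∀ {v} → v ∈ map proj₁ M → a ≼ v → v ≼ b → v ∈ map proj₁ (filter (inside? K) M)
    cover v∈ av vb with ∈-map⁻ proj₁ v∈
    ... | _ , x∈ , refl = ∈-map⁺ proj₁ (∈-filter⁺ (inside? K) x∈ (av , vb))
  countIn≤weight⇒satisfies K@(type₂ a b w) le = begin
    countOn a b (map proj₂ M)               ≤⟨ countOn≤length cover ⟩
    length (map proj₂ (filter (inside? K) M)) ≡⟨ length-map proj₂ (filter (inside? K) M) ⟩
    countIn K M                             ≤⟨ le ⟩
    w                                       ∎
    where
    open ≤-Reasoning
    cover : ∀ {v} → v ∈ map proj₂ M → a ≼ v → v ≼ b → v ∈ map proj₂ (filter (inside? K) M)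
    cover v∈ av vb with ∈-map⁻ proj₂ v∈
    ... | _ , x∈ , refl = ∈-map⁺ proj₂ (∈-filter⁺ (inside? K) x∈ (av , vb))
  countIn≤weight⇒satisfies (type₃ a b w) le = le
  countIn≤weight⇒satisfies (type₄ a b w) le = le

-- Thinning

-- Each group of four keeps its first element, so the first end of a block always survives;
-- `count-to-last` depends on this.
thin : List A → List A
thin []                       = []
thin (x ∷ [])                 = x ∷ []
thin (x ∷ _ ∷ [])             = x ∷ []
thin (x ∷ _ ∷ _ ∷ [])         = x ∷ []
thin (x ∷ _ ∷ _ ∷ _ ∷ xs)     = x ∷ thin xs

thin-⊆ : (xs : List A) → thin xs ⊆ xs
thin-⊆ (x ∷ [])                 (here e)  = here e
thin-⊆ (x ∷ _ ∷ [])             (here e)  = here e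
thin-⊆ (x ∷ _ ∷ _ ∷ [])         (here e)  = here e
thin-⊆ (x ∷ _ ∷ _ ∷ _ ∷ xs)     (here e)  = here e
thin-⊆ (x ∷ _ ∷ _ ∷ _ ∷ xs)     (there i) = there (there (there (there (thin-⊆ xs i))))

thin-chain : {c : List (Pair n n′)} → Chain c → Chain (thin c)
thin-chain {c = []}                   ch = []
thin-chain {c = x ∷ []}               ch = [] ∷ []
thin-chain {c = x ∷ _ ∷ []}           ch = [] ∷ []
thin-chain {c = x ∷ _ ∷ _ ∷ []}       ch = [] ∷ []
thin-chain {c = x ∷ _ ∷ _ ∷ _ ∷ xs} ((_ ∷ _ ∷ _ ∷ x⋖) ∷ _ ∷ _ ∷ _ ∷ ch) =
  All.tabulate (All.lookup x⋖ ∘ thin-⊆ xs) ∷ thin-chain ch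

head∈thin : (x : A) (xs : List A) → x ∈ thin (x ∷ xs)
head∈thin x []               = here refl
head∈thin x (_ ∷ [])         = here refl
head∈thin x (_ ∷ _ ∷ [])     = here refl
head∈thin x (_ ∷ _ ∷ _ ∷ _)  = here refl

-- A prefix whose length is a multiple of four leaves the groups of the remainder aligned.
thin-++ : ∀ m (xs ys : List A) → length xs ≡ m * 4 → thin (xs ++ ys) ≡ thin xs ++ thin ys
thin-++ zero    []                       ys eq = refl
thin-++ (suc m) (x ∷ _ ∷ _ ∷ _ ∷ xs)     ys eq =
  cong (x ∷_) (thin-++ m xs ys (suc-injective (suc-injective (suc-injective (suc-injective eq)))))

length-thin : ∀ m (xs : List A) → length xs ≡ m * 4 → length (thin xs) ≡ m
length-thin zero    []                       eq = refl
length-thin (suc m) (x ∷ _ ∷ _ ∷ _ ∷ xs)     eq =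
  cong suc (length-thin m xs (suc-injective (suc-injective (suc-injective (suc-injective eq)))))

length≤4*length-thin : (xs : List A) → length xs ≤ length (thin xs) * 4
length≤4*length-thin []                       = z≤n
length≤4*length-thin (x ∷ [])                 = s≤s z≤n
length≤4*length-thin (x ∷ _ ∷ [])             = s≤s (s≤s z≤n)
length≤4*length-thin (x ∷ _ ∷ _ ∷ [])         = s≤s (s≤s (s≤s z≤n))
length≤4*length-thin (x ∷ _ ∷ _ ∷ _ ∷ xs)     = s≤s (s≤s (s≤s (s≤s (length≤4*length-thin xs))))

-- Blocks

-- By convexity, a constraint containing both ends of a chain contains all its `m` elements, so a
-- weight below `m` is exceeded. Only the ends and the length have to be known.
Violated : ℕ → Pair n n′ → Pair n n′ → Constraint n n′ → Set
Violated m p q K = weight K < m × Inside K p × Inside K q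

violated? : ∀ m (p q : Pair n n′) K → Dec (Violated m p q K)
violated? m p q K = (weight K <? m) ×-dec inside? K p ×-dec inside? K q

module Blocks (D : List (Pair n n′)) (Ks : List (Constraint n n′)) where

  Admits : ℕ → Pair n n′ → Pair n n′ → Set
  Admits m p q = All (λ K → ¬ Violated m p q K) Ks

  admits? : ∀ m p q → Dec (Admits m p q)
  admits? m p q = All.all? (λ K → ¬? (violated? m p q K)) Ks

  -- The check at a node sees only the outer ends, so either half may be exchanged for another block
  -- with the same ends; dynamic programming rests on this. Leaves carry no check because weights
  -- are at least 1.
  data Block : ℕ → Pair n n′ → Pair n n′ → List (Pair n n′) → Set where
    leaf : ∀ {p} → p ∈ D → Block 0 p p (p ∷ [])
    node : ∀ {j p p′ q′ q c d} → Block j p p′ c → p′ ⋖ q′ → Block j q′ q d →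
           Admits (2 ^ suc j) p q → Block (suc j) p q (c ++ d)

  private
    variable
      j : ℕ
      p q : Pair n n′
      c d : List (Pair n n′)

  length-double : length c ≡ 2 ^ j → length d ≡ 2 ^ j → length (c ++ d) ≡ 2 ^ suc j
  length-double {c} {j} lc ld =
    trans (length-++ c) (cong₂ _+_ lc (trans ld (sym (+-identityʳ (2 ^ j)))))

  block-length : Block j p q c → length c ≡ 2 ^ j
  block-length (leaf _)       = refl
  block-length (node {j = j} {c = c} {d} b _ b′ _) =
    length-double {c} {j} {d} (block-length b) (block-length b′)

  block-⊑ : Block j p q c → p ⊑ q
  block-⊑ (leaf _)         = ⊑-refl
  block-⊑ (node b l b′ _)  = ⊑-trans (block-⊑ b) (⊑-trans (⋖⇒⊑ l) (block-⊑ b′))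

  block-first∈ : Block j p q c → p ∈ D
  block-first∈ (leaf p∈)      = p∈
  block-first∈ (node b _ _ _) = block-first∈ b

  block-last∈ : Block j p q c → q ∈ D
  block-last∈ (leaf p∈)      = p∈
  block-last∈ (node _ _ b _) = block-last∈ b

  block-⊆ : Block j p q c → c ⊆ D
  block-⊆ (leaf p∈) (here refl) = p∈
  block-⊆ (node {c = c} b _ b′ _) x∈ = [ block-⊆ b , block-⊆ b′ ]′ (∈-++⁻ c x∈)

  Between : Pair n n′ → Pair n n′ → Pair n n′ → Set
  Between p q x = p ⊑ x × x ⊑ q

  between-++ : ∀ {p′ q′} → p ⊑ p′ → p′ ⋖ q′ → q′ ⊑ q →
               All (Between p p′) c → All (Between q′ q) d → All (Between p q) (c ++ d)
  between-++ pp′ l q′q bc bd = All.++⁺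
    (All.map (λ (px , xp′) → px , ⊑-trans xp′ (⊑-trans (⋖⇒⊑ l) q′q)) bc)
    (All.map (λ (q′x , xq) → ⊑-trans pp′ (⊑-trans (⋖⇒⊑ l) q′x) , xq) bd)

  block-between : Block j p q c → All (Between p q) c
  block-between (leaf _)        = (⊑-refl , ⊑-refl) ∷ []
  block-between (node b l b′ _) = between-++ (block-⊑ b) l (block-⊑ b′) (block-between b) (block-between b′)

  block-chain : Block j p q c → Chain c
  block-chain (leaf _)        = [] ∷ []
  block-chain (node b l b′ _) = AllPairs.++⁺ (block-chain b) (block-chain b′)
    (All.map (λ (_ , xp′) → All.map (λ (q′y , _) → ⊑-⋖-trans xp′ (⋖-⊑-trans l q′y)) (block-between b′))
             (block-between b))

  -- A chain inside a feasible solution splits into blocks: a constraint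
  -- containing both ends of a segment contains the whole segment.
  chain⇒block : ∀ {N} → N ⊆ D → All (Satisfies N) Ks →
                ∀ j c → Chain c → c ⊆ N → length c ≡ 2 ^ j →
                ∃[ p ] ∃[ q ] (p ∈ c × q ∈ c × Block j p q c)
  chain⇒block N⊆D sat zero (p ∷ []) ch c⊆N eq =
    p , p , here refl , here refl , leaf (N⊆D (c⊆N (here refl)))
  chain⇒block {N} N⊆D sat (suc j) c ch c⊆N eq
    with take (2 ^ j) c | drop (2 ^ j) c | take++drop≡id (2 ^ j) c
       | length-take (2 ^ j) c | length-drop (2 ^ j) c
  ... | c₁ | c₂ | refl | len₁ | len₂
    with chain-++⁻ c₁ ch
  ... | ch₁ , ch₂ , sep
    with chain⇒block N⊆D sat j c₁ ch₁ (c⊆N ∘ ∈-++⁺ˡ)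
           (trans len₁ (trans (cong (2 ^ j ⊓_) eq) (m≤n⇒m⊓n≡m (m≤m+n (2 ^ j) _))))
       | chain⇒block N⊆D sat j c₂ ch₂ (c⊆N ∘ ∈-++⁺ʳ c₁)
           (trans len₂ (trans (cong (_∸ 2 ^ j) eq) (trans (m+n∸m≡n (2 ^ j) _) (+-identityʳ (2 ^ j)))))
  ... | p , p′ , p∈ , p′∈ , b | q′ , q , q′∈ , q∈ , b′ =
    p , q , ∈-++⁺ˡ p∈ , ∈-++⁺ʳ c₁ q∈ , node b (sep p′∈ q′∈) b′ (All.map fits sat)
    where
    between : All (Between p q) (c₁ ++ c₂)
    between = between-++ (block-⊑ b) (sep p′∈ q′∈) (block-⊑ b′) (block-between b) (block-between b′)
    fits : ∀ {K} → Satisfies N K → ¬ Violated (2 ^ suc j) p q K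
    fits {K} s (w< , ip , iq) = <⇒≱ w< (subst (_≤ weight K) eq
      (satisfies⇒length≤weight K ch c⊆N (All.map (λ (px , xq) → inside-convex K px xq ip iq) between) s))

  -- Counting inside one constraint

  -- At a node this is the stored `Admits`; at a leaf the weight would have to be below `2 ^ 0 = 1`.
  ends-not-inside : ∀ {K} → K ∈ Ks → 1 ≤ weight K → Block j p q c → weight K < 2 ^ j →
                    Inside K p → ¬ Inside K q
  ends-not-inside K∈ 1≤w (leaf _)         w< ip iq = <⇒≱ w< 1≤w
  ends-not-inside K∈ 1≤w (node _ _ _ adm) w< ip iq = All.lookup adm K∈ (w< , ip , iq)

  2^[2+k]≡2^k*4 : ∀ k → 2 ^ (2 + k) ≡ 2 ^ k * 4
  2^[2+k]≡2^k*4 k = trans (sym (*-assoc 2 2 (2 ^ k))) (*-comm 4 (2 ^ k))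

  block-head : Block j p q c → ∃[ r ] c ≡ p ∷ r
  block-head (leaf _) = _ , refl
  block-head (node b _ _ _) with block-head b
  ... | _ , refl = _ , refl

  first∈thin : Block j p q c → p ∈ thin c
  first∈thin b with block-head b
  ... | r , refl = head∈thin _ r

  length-thin-block : ∀ k → Block (2 + k) p q c → length (thin c) ≡ 2 ^ k
  length-thin-block {c = c} k b = length-thin (2 ^ k) c (trans (block-length b) (2^[2+k]≡2^k*4 k))

  thin-block-++ : ∀ i k → Block (i + (2 + k)) p q c → thin (c ++ d) ≡ thin c ++ thin d
  thin-block-++ {c = c} {d} i k b = thin-++ (2 ^ (i + k)) c d (trans (block-length b)
    (trans (cong (2 ^_) (trans (sym (+-assoc i 2 k)) (cong (_+ k) (+-comm i 2))))
           (2^[2+k]≡2^k*4 (i + k))))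

  -- From level `2 + k` on, no block has both ends inside `K`. Levels are written `i + (2 + k)`, so
  -- that induction on `i` starts at the smallest such block, of which thinning keeps `2 ^ k`
  -- elements.
  module Count {K : Constraint n n′} (K∈ : K ∈ Ks) (1≤w : 1 ≤ weight K)
               (k : ℕ) (w< : weight K < 2 ^ (2 + k)) where

    none : ∀ {c} → All (λ x → ¬ Inside K x) c → countIn K (thin c) ≡ 0
    none {c} out = cong length (filter-none (inside? K) (All.tabulate (All.lookup out ∘ thin-⊆ c)))

    ends : ∀ i → Block (i + (2 + k)) p q c → Inside K p → ¬ Inside K q
    ends i b = ends-not-inside K∈ 1≤w b (<-≤-trans w< (^-monoʳ-≤ 2 (m≤n+m (2 + k) i)))

    -- By convexity `K` cannot have elements on both sides of the outside pair `z`.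
    separated : ∀ {z c d} → ¬ Inside K z → All (_⊑ z) c → All (z ⊑_) d →
                countIn K (thin c) ≡ 0 ⊎ countIn K (thin d) ≡ 0
    separated {z} {c} {d} ¬z cz zd with any? (inside? K) c
    ... | no ¬any = inj₁ (none (All.¬Any⇒All¬ c ¬any))
    ... | yes any = inj₂ (none (All.map (λ zy iy → ¬z (inside-convex K xz zy ix iy)) zd))
      where
      x∈ = find any
      xz = All.lookup cz (proj₁ (proj₂ x∈))
      ix = proj₂ (proj₂ x∈)

    countIn-thin-++ : ∀ i → Block (i + (2 + k)) p q c →
                      countIn K (thin (c ++ d)) ≡ countIn K (thin c) + countIn K (thin d)
    countIn-thin-++ {c = c} {d} i b =
      trans (cong (countIn K) (thin-block-++ {d = d} i k b))
      (trans (cong length (filter-++ (inside? K) (thin c) (thin d)))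
             (length-++ (filter (inside? K) (thin c))))

    -- If `K` contains the first end, it misses the last end of the left half and, by convexity, the
    -- whole right half. Descending into left halves leaves one block of level `2 + k`.
    count-from-first : ∀ i → Block (i + (2 + k)) p q c → Inside K p → countIn K (thin c) ≤ 2 ^ k
    count-from-first {c = c} zero b ip =
      ≤-trans (length-filter (inside? K) (thin c)) (≤-reflexive (length-thin-block k b))
    count-from-first (suc i) (node {c = c} {d} b l b′ _) ip = begin
      countIn K (thin (c ++ d))                     ≡⟨ countIn-thin-++ {d = d} i b ⟩
      countIn K (thin c) + countIn K (thin d)       ≡⟨ cong (countIn K (thin c) +_) (none outside) ⟩
      countIn K (thin c) + 0                        ≡⟨ +-identityʳ _ ⟩
      countIn K (thin c)                            ≤⟨ count-from-first i b ip ⟩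
      2 ^ k                                         ∎
      where
      open ≤-Reasoning
      outside : All (λ x → ¬ Inside K x) d
      outside = All.map (λ (q′x , _) ix →
        ends i b ip (inside-convex K (block-⊑ b) (⊑-trans (⋖⇒⊑ l) q′x) ip ix)) (block-between b′)

    -- The mirror image of `count-from-first`, with a gain of one: the first element of the final
    -- block is kept by thinning yet lies outside `K`. This gain turns the total `2 ^ suc k` into
    -- `2 ^ suc k - 1`, which the weight can afford.
    count-to-last : ∀ i → Block (i + (2 + k)) p q c → Inside K q → countIn K (thin c) < 2 ^ k
    count-to-last {p = p} {c = c} zero b iq = begin-strict
      countIn K (thin c)   <⟨ filter-notAll (inside? K) (thin c) (lose (first∈thin b) (λ ip → ends 0 b ip iq)) ⟩
      length (thin c)      ≡⟨ length-thin-block k b ⟩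
      2 ^ k                ∎
      where open ≤-Reasoning
    count-to-last (suc i) (node {c = c} {d} b l b′ _) iq = begin-strict
      countIn K (thin (c ++ d))                     ≡⟨ countIn-thin-++ {d = d} i b ⟩
      countIn K (thin c) + countIn K (thin d)       ≡⟨ cong (_+ countIn K (thin d)) (none outside) ⟩
      countIn K (thin d)                            <⟨ count-to-last i b′ iq ⟩
      2 ^ k                                         ∎
      where
      open ≤-Reasoning
      outside : All (λ x → ¬ Inside K x) c
      outside = All.map (λ (_ , xp′) ix →
        ends i b′ (inside-convex K (⊑-trans xp′ (⋖⇒⊑ l)) (block-⊑ b′) ix iq) iq) (block-between b)

    -- If the constraint reaches across the middle of a block, it meets the
    -- two halves in a final and an initial segment.
    count-thin : ∀ i → Block (i + (2 + k)) p q c → countIn K (thin c) < 2 ^ suc k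
    count-thin {c = c} zero b = begin-strict
      countIn K (thin c)   ≤⟨ length-filter (inside? K) (thin c) ⟩
      length (thin c)      ≡⟨ length-thin-block k b ⟩
      2 ^ k                <⟨ ^-monoʳ-< 2 (s≤s (s≤s z≤n)) (n<1+n k) ⟩
      2 ^ suc k            ∎
      where open ≤-Reasoning
    count-thin (suc i) (node {p′ = p′} {q′} {c = c} {d} b l b′ _) =
      subst (_< 2 ^ suc k) (sym (countIn-thin-++ {d = d} i b)) (by-cases (inside? K p′) (inside? K q′))
      where
      one-sided : countIn K (thin c) ≡ 0 ⊎ countIn K (thin d) ≡ 0 →
                  countIn K (thin c) + countIn K (thin d) < 2 ^ suc k
      one-sided (inj₁ e) = subst (λ m → m + countIn K (thin d) < 2 ^ suc k) (sym e) (count-thin i b′)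
      one-sided (inj₂ e) = subst (_< 2 ^ suc k) (trans (sym (+-identityʳ _)) (cong (countIn K (thin c) +_) (sym e)))
                             (count-thin i b)
      by-cases : Dec (Inside K p′) → Dec (Inside K q′) → countIn K (thin c) + countIn K (thin d) < 2 ^ suc k
      by-cases (yes ip′) (yes iq′) = subst (λ m → countIn K (thin c) + countIn K (thin d) < 2 ^ k + m)
        (sym (+-identityʳ (2 ^ k))) (+-mono-<-≤ (count-to-last i b ip′) (count-from-first i b′ iq′))
      by-cases (no ¬ip′) _ = one-sided (separated ¬ip′ (All.map proj₂ (block-between b))
        (All.map (⊑-trans (⋖⇒⊑ l) ∘ proj₁) (block-between b′)))
      by-cases _ (no ¬iq′) = one-sided (separated ¬iq′
        (All.map (λ (_ , xp′) → ⊑-trans xp′ (⋖⇒⊑ l)) (block-between b)) (All.map proj₁ (block-between b′)))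

  -- Going up from weight 1, `k` is kept until the weight reaches `2 ^ (2 + k)` and is then
  -- increased; the lower bound for the new `k` holds at that moment.
  scale : ∀ w → 1 ≤ w → ∃[ k ] (w < 2 ^ (2 + k) × 2 ^ suc k ≤ suc w)
  scale (suc zero)    _ = 0 , s≤s (s≤s z≤n) , ≤-refl
  scale (suc (suc w)) _ with scale (suc w) (s≤s z≤n)
  ... | k , w< , ≤w with suc (suc w) <? 2 ^ (2 + k)
  ...   | yes w′< = k , w′< , m≤n⇒m≤1+n ≤w
  ...   | no  w′≮ = suc k , ≤-<-trans w< (^-monoʳ-< 2 (s≤s (s≤s z≤n)) (n<1+n (2 + k))) , m≤n⇒m≤1+n (≮⇒≥ w′≮)

  -- Blocks below level `2 + k` are too small for `Count`. Levels 0 and 1 are separate, since they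
  -- have fewer than four elements and thin to a single one.
  length-thin-small : ∀ j k → j ≤ 1 + k → Block j p q c → length (thin c) ≤ 2 ^ k
  length-thin-small {c = c} zero k j≤ b with c | block-length b
  ... | _ ∷ [] | _ = m^n>0 2 k
  length-thin-small {c = c} (suc zero) k j≤ b with c | block-length b
  ... | _ ∷ _ ∷ [] | _ = m^n>0 2 k
  length-thin-small (suc (suc j)) k (s≤s j≤) b =
    subst (_≤ 2 ^ k) (sym (length-thin-block j b)) (^-monoʳ-≤ 2 (≤-trans (n≤1+n j) j≤))

  countIn-thin≤weight : ∀ {K} → K ∈ Ks → 1 ≤ weight K → Block j p q c → countIn K (thin c) ≤ weight K
  countIn-thin≤weight {j} {c = c} {K = K} K∈ 1≤w b with scale (weight K) 1≤w
  ... | k , w< , ≤w with j <? 2 + k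
  ...   | yes (s≤s j≤) = begin
    countIn K (thin c)   ≤⟨ length-filter (inside? K) (thin c) ⟩
    length (thin c)      ≤⟨ length-thin-small j k j≤ b ⟩
    -- From `2 ^ k < 2 ^ suc k ≤ suc w`, where `w` is the weight.
    2 ^ k                ≤⟨ s≤s⁻¹ (≤-trans (^-monoʳ-< 2 (s≤s (s≤s z≤n)) (n<1+n k)) ≤w) ⟩
    weight K             ∎
    where open ≤-Reasoning
  ...   | no j≮ = s≤s⁻¹ (≤-trans (Count.count-thin K∈ 1≤w k w< (j ∸ (2 + k))
                    (subst (λ m → Block m _ _ c) (sym (m∸n+n≡m (≮⇒≥ j≮))) b)) ≤w)

-- Tables of blocks

-- Equality is decided on encodings, as the program does it.

_≟ᵀ_ : (x y : Tree) → Dec (x ≡ y)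
nil      ≟ᵀ nil      = yes refl
nil      ≟ᵀ cons _ _ = no λ ()
cons _ _ ≟ᵀ nil      = no λ ()
cons a b ≟ᵀ cons c d = map′ (uncurry (cong₂ cons)) (λ where refl → refl , refl) ((a ≟ᵀ c) ×-dec (b ≟ᵀ d))

encodeℕ-injective : ∀ {a b} → encodeℕ a ≡ encodeℕ b → a ≡ b
encodeℕ-injective {zero}  {zero}  _  = refl
encodeℕ-injective {suc a} {suc b} eq with encodeℕ a in ea | encodeℕ b in eb
encodeℕ-injective {suc a} {suc b} refl | _ | _ = cong suc (encodeℕ-injective (trans ea (sym eb)))

encodePair-injective : {p q : Pair n n′} → encodePair p ≡ encodePair q → p ≡ q
encodePair-injective {p = s , t} {s′ , t′} eq
  with encodeℕ (position s) in es | encodeℕ (position t) in et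
     | encodeℕ (position s′) in es′ | encodeℕ (position t′) in et′
encodePair-injective refl | _ | _ | _ | _ =
  cong₂ _,_ (toℕ-injective (encodeℕ-injective (trans es (sym es′))))
            (toℕ-injective (encodeℕ-injective (trans et (sym et′))))

_≟ᴾ_ : (p q : Pair n n′) → Dec (p ≡ q)
p ≟ᴾ q = map′ encodePair-injective (cong encodePair) (encodePair p ≟ᵀ encodePair q)

-- Going through `does` makes the value depend only on the Boolean that the program computes.
orElse : {P : Set} → Dec P → A → Maybe A → Maybe A
orElse d x m = if does d then just x else m

orElse-sound : ∀ {P : Set} (d : Dec P) {x e : A} m → orElse d x m ≡ just e → (P × e ≡ x) ⊎ m ≡ just e
orElse-sound (yes p) m refl = inj₁ (p , refl)
orElse-sound (no _)  m eq   = inj₂ eq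

orElse-complete : ∀ {P : Set} (d : Dec P) {x : A} m → P ⊎ ∃[ e ] m ≡ just e → ∃[ e ] orElse d x m ≡ just e
orElse-complete (yes _) m _        = _ , refl
orElse-complete (no ¬p) m (inj₁ p) = contradiction p ¬p
orElse-complete (no _)  m (inj₂ h) = h

-- An entry is a chain together with its first and last elements.
Entry : ℕ → ℕ → Set
Entry n n′ = List (Pair n n′) × (Pair n n′ × Pair n n′)

module Tables (D : List (Pair n n′)) (Ks : List (Constraint n n′)) where
  open Blocks D Ks

  -- The length of the joined chain replaces `2 ^ suc j`, because the program does not keep track of
  -- the level.
  Joinable : Pair n n′ × Pair n n′ → Entry n n′ × Entry n n′ → Set
  Joinable (p , q) ((c , p₀ , p′) , (d , q′ , q₀)) =
    p₀ ≡ p × q₀ ≡ q × p′ ⋖ q′ × Admits (length (c ++ d)) p q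

  joinable? : ∀ pq ef → Dec (Joinable pq ef)
  joinable? (p , q) ((c , p₀ , p′) , (d , q′ , q₀)) =
    (p₀ ≟ᴾ p) ×-dec (q₀ ≟ᴾ q) ×-dec
    ((proj₁ p′ ≺? proj₁ q′) ×-dec (proj₂ p′ ≺? proj₂ q′)) ×-dec
    admits? (length (c ++ d)) p q

  join : Pair n n′ × Pair n n′ → Entry n n′ × Entry n n′ → Entry n n′
  join pq (e , f) = proj₁ e ++ proj₁ f , pq

  search : Pair n n′ × Pair n n′ → List (Entry n n′ × Entry n n′) → Maybe (Entry n n′)
  search pq []         = nothing
  search pq (ef ∷ efs) = orElse (joinable? pq ef) (join pq ef) (search pq efs)

  nextTable : List (Pair n n′ × Pair n n′) → List (Entry n n′ × Entry n n′) → List (Entry n n′)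
  nextTable []         efs = []
  nextTable (pq ∷ pqs) efs = maybe′ _∷_ id (search pq efs) (nextTable pqs efs)

  search-sound : ∀ pq efs {e} → search pq efs ≡ just e →
                 ∃[ ef ] (ef ∈ efs × Joinable pq ef × e ≡ join pq ef)
  search-sound pq (ef ∷ efs) eq with orElse-sound (joinable? pq ef) (search pq efs) eq
  ... | inj₁ (jn , refl) = ef , here refl , jn , refl
  ... | inj₂ eq′ with search-sound pq efs eq′
  ...   | ef′ , ef′∈ , rest = ef′ , there ef′∈ , rest

  search-complete : ∀ pq efs {ef} → ef ∈ efs → Joinable pq ef → ∃[ e ] search pq efs ≡ just e
  search-complete pq (ef ∷ efs) (here refl) jn = orElse-complete (joinable? pq ef) _ (inj₁ jn)
  search-complete pq (ef ∷ efs) (there ef∈) jn =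
    orElse-complete (joinable? pq ef) _ (inj₂ (search-complete pq efs ef∈ jn))

  -- At most one entry is stored per pair of ends, which keeps the tables of all levels polynomial.
  length-nextTable : ∀ pqs efs → length (nextTable pqs efs) ≤ length pqs
  length-nextTable []         efs = z≤n
  length-nextTable (pq ∷ pqs) efs with search pq efs
  ... | nothing = m≤n⇒m≤1+n (length-nextTable pqs efs)
  ... | just _  = s≤s (length-nextTable pqs efs)

  nextTable-sound : ∀ pqs efs {e} → e ∈ nextTable pqs efs →
                    ∃[ pq ] ∃[ ef ] (ef ∈ efs × Joinable pq ef × e ≡ join pq ef)
  nextTable-sound (pq ∷ pqs) efs e∈ with search pq efs in eq
  nextTable-sound (pq ∷ pqs) efs e∈          | nothing = nextTable-sound pqs efs e∈
  nextTable-sound (pq ∷ pqs) efs (here refl) | just _  = pq , search-sound pq efs eq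
  nextTable-sound (pq ∷ pqs) efs (there e∈)  | just _  = nextTable-sound pqs efs e∈

  nextTable-complete : ∀ {pq ef} pqs efs → pq ∈ pqs → ef ∈ efs → Joinable pq ef →
                       ∃[ c ] (c , pq) ∈ nextTable pqs efs
  nextTable-complete (pq ∷ pqs) efs (here refl) ef∈ jn
    with search pq efs | search-complete pq efs ef∈ jn | search-sound pq efs
  ... | just _ | _ , refl | sound with sound refl
  ...   | _ , _ , _ , refl = _ , here refl
  nextTable-complete (pq ∷ pqs) efs (there pq∈) ef∈ jn
    with search pq efs | nextTable-complete pqs efs pq∈ ef∈ jn
  ... | nothing | c , c∈ = c , c∈
  ... | just _  | c , c∈ = c , there c∈

  -- Completeness promises some chain with the given ends rather than the given chain: joining looks
  -- only at ends and lengths, so one representative suffices.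
  record IsTable (j : ℕ) (T : List (Entry n n′)) : Set where
    field
      sound    : ∀ {c p q} → (c , p , q) ∈ T → Block j p q c
      complete : ∀ {c p q} → Block j p q c → ∃[ d ] (d , p , q) ∈ T

  open IsTable

  firstTable : List (Pair n n′) → List (Entry n n′)
  firstTable = map (λ p → p ∷ [] , p , p)

  firstTable-isTable : IsTable 0 (firstTable D)
  firstTable-isTable .sound e∈ with ∈-map⁻ _ e∈
  ... | _ , p∈ , refl = leaf p∈
  firstTable-isTable .complete (leaf p∈) = _ , ∈-map⁺ _ p∈

  -- For completeness, both halves of a block are replaced by their representatives in `T`, which
  -- have the same ends and the same length and are therefore still joinable.
  nextTable-isTable : ∀ {j T} → IsTable j T →
                      IsTable (suc j) (nextTable (cartesianProduct D D) (cartesianProduct T T))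
  nextTable-isTable {j} {T} t .sound e∈
    with nextTable-sound (cartesianProduct D D) (cartesianProduct T T) e∈
  ... | (p , q) , ((c , _ , p′) , (d , q′ , _)) , ef∈ , (refl , refl , l , adm) , refl
    with ∈-cartesianProduct⁻ T T ef∈
  ... | e∈T , f∈T = node b l b′
    (subst (λ m → Admits m p q) (length-double {c} {j} {d} (block-length b) (block-length b′)) adm)
    where
    b = sound t e∈T
    b′ = sound t f∈T
  nextTable-isTable {j} {T} t .complete {p = p} {q} (node b l b′ adm)
    with complete t b | complete t b′
  ... | c , e∈ | d , f∈ = nextTable-complete (cartesianProduct D D) (cartesianProduct T T)
    (∈-cartesianProduct⁺ (block-first∈ b) (block-last∈ b′)) (∈-cartesianProduct⁺ e∈ f∈)
    (refl , refl , l , subst (λ m → Admits m p q)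
      (sym (length-double {c} {j} {d} (block-length (sound t e∈)) (block-length (sound t f∈)))) adm)

-- Feasibility and approximation ratio of thinned blocks

admissible⇒1≤weight : ∀ {k} (K : Constraint n n′) → Admissible k K → 1 ≤ weight K
admissible⇒1≤weight (type₁ _ _ _) (_ , 1≤w , _) = 1≤w
admissible⇒1≤weight (type₂ _ _ _) (_ , 1≤w , _) = 1≤w
admissible⇒1≤weight (type₃ _ _ _) (1≤w , _)     = 1≤w
admissible⇒1≤weight (type₄ _ _ _) (1≤w , _)     = 1≤w

admissible⇒weight≤ : ∀ {k} (K : Constraint n n′) → Admissible k K → weight K ≤ k
admissible⇒weight≤ (type₁ _ _ _) (_ , _ , w≤k) = w≤k
admissible⇒weight≤ (type₂ _ _ _) (_ , _ , w≤k) = w≤k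
admissible⇒weight≤ (type₃ _ _ _) (_ , w≤k)     = w≤k
admissible⇒weight≤ (type₄ _ _ _) (_ , w≤k)     = w≤k

module _ (I : Instance) where
  open Instance I
  open Blocks demands constraints
  open Tables demands constraints
  open IsTable

  thin-block-feasible : ∀ {j p q c} → Block j p q c → Feasible I (thin c)
  thin-block-feasible {c = c} b = record
    { unique      = chain⇒unique (thin-chain (block-chain b))
    ; subset      = block-⊆ b ∘ thin-⊆ c
    ; nonCrossing = chain⇒nonCrossing (thin-chain (block-chain b))
    ; satisfies   = All.tabulate λ {K} K∈ → countIn≤weight⇒satisfies K
        (countIn-thin≤weight K∈ (admissible⇒1≤weight K (All.lookup admissible K∈)) b)
    }

  []-feasible : Feasible I []
  []-feasible = record
    { unique      = []
    ; subset      = λ ()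
    ; nonCrossing = λ ()
    ; satisfies   = All.tabulate λ {K} _ → countIn≤weight⇒satisfies K z≤n
    }

  -- Otherwise the first `2 ^ j` elements of `N`, sorted into a chain, would form a block of level
  -- `j`, which a complete table cannot miss.
  feasible-length< : ∀ {j N} → IsTable j [] → Feasible I N → length N < 2 ^ j
  feasible-length< {j} {N} t feas with length N <? 2 ^ j
  ... | yes N< = N<
  ... | no N≮ with nonCrossing⇒chain (Feasible.unique feas) (Feasible.nonCrossing feas)
  ...   | c , ch , sub , len
    with chain⇒block (Feasible.subset feas) (Feasible.satisfies feas) j (take (2 ^ j) c)
           (AllPairs.take⁺ (2 ^ j) ch) (sub ∘ subst (_ ∈_) (take++drop≡id (2 ^ j) c) ∘ ∈-++⁺ˡ)
           (trans (length-take (2 ^ j) c) (m≤n⇒m⊓n≡m (subst (2 ^ j ≤_) (sym len) (≮⇒≥ N≮))))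
  ...   | _ , _ , _ , _ , b with complete t b
  ...   | ()

  thin-block-approximates : ∀ {j p q c N} → IsTable (suc j) [] → Block j p q c → Feasible I N →
                            length N ≤ 8 * length (thin c)
  thin-block-approximates {j} {c = c} {N} t b feas = begin
    length N                      ≤⟨ <⇒≤ (feasible-length< t feas) ⟩
    2 * 2 ^ j                     ≡⟨ cong (2 *_) (block-length b) ⟨
    2 * length c                  ≤⟨ *-monoʳ-≤ 2 (length≤4*length-thin c) ⟩
    2 * (length (thin c) * 4)     ≡⟨ cong (2 *_) (*-comm (length (thin c)) 4) ⟩
    2 * (4 * length (thin c))     ≡⟨ *-assoc 2 4 (length (thin c)) ⟨
    8 * length (thin c)           ∎
    where open ≤-Reasoning

-- The program

-- A truth value is nil for true and cons nil nil for false, so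
-- that the true branch of a match binds no variables.  The comment above each
-- body lists its arguments, in the order of their de Bruijn indices.

arity : Fin 14 → ℕ
arity = lookup (2 ∷ 2 ∷ 4 ∷ 4 ∷ 4 ∷ 2 ∷ 3 ∷ 3 ∷ 3 ∷ 3 ∷ 2 ∷ 1 ∷ 1 ∷ 3 ∷ [])

pattern LE        = zero
pattern EQ        = suc LE
pattern INSIDE    = suc EQ
pattern VIOLATED  = suc INSIDE
pattern ADMITS    = suc VIOLATED
pattern APPEND    = suc ADMITS
pattern JOIN      = suc APPEND
pattern SEARCH    = suc JOIN
pattern NEXT      = suc SEARCH
pattern ROW       = suc NEXT
pattern PRODUCT   = suc ROW
pattern FIRST     = suc PRODUCT
pattern THIN      = suc FIRST
pattern ITERATE   = suc THIN

v : ∀ m {k} {m<k : True (m <? k)} → Exp arity k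
v m {m<k = m<k} = var (#_ m {m<n = m<k})

true′ false′ : ∀ {k} → Exp arity k
true′  = nil
false′ = cons nil nil

infixr 6 _and_
_and_ : ∀ {k} → Exp arity k → Exp arity k → Exp arity k
e₁ and e₂ = match e₁ e₂ false′

body : (f : Fin 14) → Exp arity (arity f)
-- x , y
body LE = match (v 0) true′ (match (v 3) false′ (call LE (v 3 ∷ v 1 ∷ [])))
-- x , y
body EQ = match (v 0) (match (v 1) true′ false′)
  (match (v 3) false′ (call EQ (v 2 ∷ v 0 ∷ []) and call EQ (v 3 ∷ v 1 ∷ [])))
-- type , a , b , (s , t)
body INSIDE = match (v 3) nil (match (v 2) nil (match (v 1)
  (call LE (v 5 ∷ v 2 ∷ []) and call LE (v 2 ∷ v 6 ∷ [])) (match (v 1)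
  (call LE (v 7 ∷ v 5 ∷ []) and call LE (v 5 ∷ v 8 ∷ [])) (match (v 1)
  (call LE (v 6 ∷ v 9 ∷ []) and call LE (v 10 ∷ v 7 ∷ []))
  (call LE (v 11 ∷ v 8 ∷ []) and call LE (v 9 ∷ v 12 ∷ []))))))
-- constraint , p , q , chain
body VIOLATED = match (v 0) nil (match (v 1) nil (match (v 1) nil
  (call LE (cons nil (v 1) ∷ v 9 ∷ [])
    and call INSIDE (v 4 ∷ v 2 ∷ v 0 ∷ v 7 ∷ [])
    and call INSIDE (v 4 ∷ v 2 ∷ v 0 ∷ v 8 ∷ []))))
-- p , q , chain , constraints
body ADMITS = match (v 3) true′
  (match (call VIOLATED (v 0 ∷ v 2 ∷ v 3 ∷ v 4 ∷ [])) false′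
    (call ADMITS (v 4 ∷ v 5 ∷ v 6 ∷ v 3 ∷ [])))
-- xs , ys
body APPEND = match (v 0) (v 1) (cons (v 0) (call APPEND (v 1 ∷ v 3 ∷ [])))
-- (p , q) , ((c , p₀ , p′) , (d , q′ , q₀)) , constraints
body JOIN =
  match (v 0) nil (match (v 3) nil (match (v 0) nil (match (v 1) nil
  (match (v 5) nil (match (v 1) nil (match (v 5) nil (match (v 2) nil
  (bind (call APPEND (v 10 ∷ v 6 ∷ []))
  (match (call EQ (v 9 ∷ v 15 ∷ [])
      and call EQ (v 6 ∷ v 16 ∷ [])
      and (call LE (cons nil (v 3) ∷ v 1 ∷ []) and call LE (cons nil (v 4) ∷ v 2 ∷ []))
      and call ADMITS (v 15 ∷ v 16 ∷ v 0 ∷ v 19 ∷ []))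
    (cons (v 0) (v 17)) nil)))))))))
-- (p , q) , pairs of entries , constraints
body SEARCH = match (v 1) nil
  (match (call JOIN (v 2 ∷ v 0 ∷ v 4 ∷ [])) (call SEARCH (v 2 ∷ v 1 ∷ v 4 ∷ [])) (cons (v 0) (v 1)))
-- pairs of demands , pairs of entries , constraints
body NEXT = match (v 0) nil
  (match (call SEARCH (v 0 ∷ v 3 ∷ v 4 ∷ [])) (call NEXT (v 1 ∷ v 3 ∷ v 4 ∷ []))
    (cons (cons (v 0) (v 1)) (call NEXT (v 3 ∷ v 5 ∷ v 6 ∷ []))))
-- x , ys , zs
body ROW = match (v 1) (v 2) (cons (cons (v 2) (v 0)) (call ROW (v 2 ∷ v 1 ∷ v 4 ∷ [])))
-- xs , ys
body PRODUCT = match (v 0) nil (call ROW (v 0 ∷ v 3 ∷ call PRODUCT (v 1 ∷ v 3 ∷ []) ∷ []))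
-- demands
body FIRST = match (v 0) nil
  (cons (cons (cons (v 0) nil) (cons (v 0) (v 0))) (call FIRST (v 1 ∷ [])))
-- xs
body THIN = match (v 0) nil (cons (v 0)
  (match (v 1) nil (match (v 1) nil (match (v 1) nil (call THIN (v 1 ∷ []))))))
-- table , pairs of demands , constraints
body ITERATE = match (v 0) nil
  (bind (call NEXT (v 3 ∷ call PRODUCT (v 2 ∷ v 2 ∷ []) ∷ v 4 ∷ []))
  (match (v 0) (match (v 1) nil (call THIN (v 0 ∷ [])))
    (call ITERATE (v 2 ∷ v 6 ∷ v 7 ∷ []))))

program : Program
program = record
  { arity = arity
  ; body  = body
  ; main  = match (v 0) nil (match (v 1) nil (match (v 1) nil
      (call ITERATE (call FIRST (v 0 ∷ []) ∷ call PRODUCT (v 0 ∷ v 0 ∷ []) ∷ v 1 ∷ []))))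
  }

open Semantics body

-- Cost accounting

-- Outside of calls every node of an expression is evaluated
-- at most once, so only the costs of the called bodies need to be tracked.

mutual
  nodes : ∀ {k} → Exp arity k → ℕ
  nodes (var _)         = 1
  nodes nil             = 1
  nodes (cons e₁ e₂)    = 1 + nodes e₁ + nodes e₂
  nodes (match e e₁ e₂) = 1 + nodes e + (nodes e₁ + nodes e₂)
  nodes (bind e₁ e₂)    = 1 + nodes e₁ + nodes e₂
  nodes (call _ es)     = 1 + nodes* es

  nodes* : ∀ {k m} → Vec (Exp arity k) m → ℕ
  nodes* []       = 0
  nodes* (e ∷ es) = nodes e + nodes* es

∣_∣ : Fin 14 → ℕ
∣ f ∣ = nodes (body f)

record Eval {k} (ρ : Vec Tree k) (e : Exp arity k) (x : Tree) (C : ℕ) : Set where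
  constructor eval
  field
    {time}     : ℕ
    evaluation : ρ ⊢ e ⇓ x [ time ]
    bound      : time ≤ nodes e + C

record Evals {k m} (ρ : Vec Tree k) (es : Vec (Exp arity k) m) (xs : Vec Tree m) (C : ℕ) : Set where
  constructor evals
  field
    {time}     : ℕ
    evaluation : ρ ⊢* es ⇓ xs [ time ]
    bound      : time ≤ nodes* es + C

record Runs (f : Fin 14) (xs : Vec Tree (arity f)) (x : Tree) (B : ℕ) : Set where
  constructor runs
  field
    {time}     : ℕ
    evaluation : xs ⊢ body f ⇓ x [ time ]
    bound      : time ≤ B

+-mono-interchange : ∀ {t₁ t₂ C₁ C₂} a b → t₁ ≤ a + C₁ → t₂ ≤ b + C₂ → t₁ + t₂ ≤ (a + b) + (C₁ + C₂)
+-mono-interchange {C₁ = C₁} {C₂} a b h₁ h₂ = ≤-trans (+-mono-≤ h₁ h₂) (≤-reflexive (interchange +-commutativeSemigroup a C₁ b C₂))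

module _ {k} {ρ : Vec Tree k} where

  weaken : ∀ {e x C C′} → C ≤ C′ → Eval ρ e x C → Eval ρ e x C′
  weaken {e} C≤ (eval d h) = eval d (≤-trans h (+-monoʳ-≤ (nodes e) C≤))

  ⟨var⟩ : ∀ {i} → Eval ρ (var i) (lookup ρ i) 0
  ⟨var⟩ = eval var ≤-refl

  ⟨nil⟩ : Eval ρ nil nil 0
  ⟨nil⟩ = eval nil ≤-refl

  ⟨cons⟩ : ∀ {e₁ e₂ x₁ x₂ C₁ C₂} → Eval ρ e₁ x₁ C₁ → Eval ρ e₂ x₂ C₂ →
           Eval ρ (cons e₁ e₂) (cons x₁ x₂) (C₁ + C₂)
  ⟨cons⟩ {e₁} {e₂} (eval d₁ h₁) (eval d₂ h₂) =
    eval (cons d₁ d₂) (s≤s (+-mono-interchange (nodes e₁) (nodes e₂) h₁ h₂))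

  ⟨match-nil⟩ : ∀ {e e₁ e₂ x C C₁} → Eval ρ e nil C → Eval ρ e₁ x C₁ →
                Eval ρ (match e e₁ e₂) x (C + C₁)
  ⟨match-nil⟩ {e} {e₁} {e₂} (eval d h) (eval d₁ h₁) =
    eval (match-nil d d₁) (s≤s (+-mono-interchange (nodes e) (nodes e₁ + nodes e₂) h
      (≤-trans h₁ (+-monoˡ-≤ _ (m≤m+n (nodes e₁) (nodes e₂))))))

  ⟨match-cons⟩ : ∀ {e e₁ e₂ l r x C C₂} → Eval ρ e (cons l r) C → Eval (l ∷ r ∷ ρ) e₂ x C₂ →
                 Eval ρ (match e e₁ e₂) x (C + C₂)
  ⟨match-cons⟩ {e} {e₁} {e₂} (eval d h) (eval d₂ h₂) =
    eval (match-cons d d₂) (s≤s (+-mono-interchange (nodes e) (nodes e₁ + nodes e₂) h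
      (≤-trans h₂ (+-monoˡ-≤ _ (m≤n+m (nodes e₂) (nodes e₁))))))

  ⟨bind⟩ : ∀ {e₁ e₂ x₁ x₂ C₁ C₂} → Eval ρ e₁ x₁ C₁ → Eval (x₁ ∷ ρ) e₂ x₂ C₂ →
           Eval ρ (bind e₁ e₂) x₂ (C₁ + C₂)
  ⟨bind⟩ {e₁} {e₂} (eval d₁ h₁) (eval d₂ h₂) =
    eval (bind d₁ d₂) (s≤s (+-mono-interchange (nodes e₁) (nodes e₂) h₁ h₂))

  ⟨[]⟩ : Evals ρ [] [] 0
  ⟨[]⟩ = evals [] ≤-refl

  infixr 5 _⟨∷⟩_
  _⟨∷⟩_ : ∀ {m e x C₁ C₂} {es : Vec (Exp arity k) m} {xs} →
          Eval ρ e x C₁ → Evals ρ es xs C₂ → Evals ρ (e ∷ es) (x ∷ xs) (C₁ + C₂)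
  _⟨∷⟩_ {e = e} {es = es} (eval d₁ h₁) (evals d₂ h₂) =
    evals (d₁ ∷ d₂) (+-mono-interchange (nodes e) (nodes* es) h₁ h₂)

  ⟨call⟩ : ∀ {f es xs x C B} → Evals ρ es xs C → Runs f xs x B → Eval ρ (call f es) x (C + B)
  ⟨call⟩ {es = es} {C = C} {B} (evals d₁ h₁) (runs d₂ h₂) = eval (call d₁ d₂)
    (s≤s (≤-trans (+-mono-≤ h₁ h₂) (≤-reflexive (+-assoc (nodes* es) C B))))

⟨body⟩ : ∀ {f xs x C} → Eval xs (body f) x C → Runs f xs x (∣ f ∣ + C)
⟨body⟩ (eval d h) = runs d h

relax : ∀ {f xs x B B′} → B ≤ B′ → Runs f xs x B → Runs f xs x B′
relax B≤ (runs d h) = runs d (≤-trans h B≤)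

encodeBool : Bool → Tree
encodeBool true  = nil
encodeBool false = cons nil nil

-- A false first operand skips the second, whose cost is charged all the same, so one bound serves
-- both outcomes.
⟨and⟩ : ∀ {k} {ρ : Vec Tree k} {e₁ e₂ C₁ C₂} b₁ {b₂} →
        Eval ρ e₁ (encodeBool b₁) C₁ → Eval ρ e₂ (encodeBool b₂) C₂ →
        Eval ρ (e₁ and e₂) (encodeBool (b₁ ∧ b₂)) (C₁ + C₂)
⟨and⟩ true  E₁ E₂ = ⟨match-nil⟩ E₁ E₂
⟨and⟩ {C₁ = C₁} false E₁ E₂ = weaken (+-monoʳ-≤ C₁ z≤n) (⟨match-cons⟩ E₁ (⟨cons⟩ ⟨nil⟩ ⟨nil⟩))

-- The cost of a loop of m rounds whose body has c nodes and calls of cost s.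
loopTime : ℕ → ℕ → ℕ → ℕ
loopTime c s zero    = c
loopTime c s (suc m) = c + (s + loopTime c s m)

-- The closing call, of cost `c`, is charged as a full round; hence `suc M`.
loopTime-≤ : ∀ c s {m M} → m ≤ M → loopTime c s m ≤ suc M * (c + s)
loopTime-≤ c s {zero}  {M} _ = ≤-trans (m≤m+n c s) (m≤m+n (c + s) (M * (c + s)))
loopTime-≤ c s {suc m} (s≤s m≤M) =
  ≤-trans (≤-reflexive (sym (+-assoc c s _))) (+-monoʳ-≤ (c + s) (loopTime-≤ c s m≤M))

-- Polynomial time bounds

infixl 6 _⊕_
infixl 7 _⊗_

data Poly : Set where
  κ       : ℕ → Poly
  X       : Poly
  _⊕_ _⊗_ : Poly → Poly → Poly

⟦_⟧ : Poly → ℕ → ℕ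
⟦ κ a ⟧   N = a
⟦ X ⟧     N = N
⟦ P ⊕ Q ⟧ N = ⟦ P ⟧ N + ⟦ Q ⟧ N
⟦ P ⊗ Q ⟧ N = ⟦ P ⟧ N * ⟦ Q ⟧ N

-- For a sum the exponents are added rather than maximised; `1 ≤ N` allows both powers to be raised
-- to the common exponent.
monomial-bound : ∀ P → ∃[ c ] ∃[ d ] (∀ N → 1 ≤ N → ⟦ P ⟧ N ≤ c * N ^ d)
monomial-bound (κ a) = a , 0 , λ N _ → ≤-reflexive (sym (*-identityʳ a))
monomial-bound X     = 1 , 1 , λ N _ → ≤-reflexive (sym (trans (+-identityʳ (N * 1)) (*-identityʳ N)))
monomial-bound (P ⊕ Q) with monomial-bound P | monomial-bound Q
... | c₁ , d₁ , h₁ | c₂ , d₂ , h₂ = c₁ + c₂ , d₁ + d₂ , λ N 1≤N → let instance N≢0 = >-nonZero 1≤N in begin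
    ⟦ P ⟧ N + ⟦ Q ⟧ N                             ≤⟨ +-mono-≤ (h₁ N 1≤N) (h₂ N 1≤N) ⟩
    c₁ * N ^ d₁ + c₂ * N ^ d₂                     ≤⟨ +-mono-≤ (*-monoʳ-≤ c₁ (^-monoʳ-≤ N (m≤m+n d₁ d₂)))
                                                              (*-monoʳ-≤ c₂ (^-monoʳ-≤ N (m≤n+m d₂ d₁))) ⟩
    c₁ * N ^ (d₁ + d₂) + c₂ * N ^ (d₁ + d₂)       ≡⟨ *-distribʳ-+ (N ^ (d₁ + d₂)) c₁ c₂ ⟨
    (c₁ + c₂) * N ^ (d₁ + d₂)                     ∎
  where open ≤-Reasoning
monomial-bound (P ⊗ Q) with monomial-bound P | monomial-bound Q
... | c₁ , d₁ , h₁ | c₂ , d₂ , h₂ = c₁ * c₂ , d₁ + d₂ , λ N 1≤N → begin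
    ⟦ P ⟧ N * ⟦ Q ⟧ N                     ≤⟨ *-mono-≤ (h₁ N 1≤N) (h₂ N 1≤N) ⟩
    (c₁ * N ^ d₁) * (c₂ * N ^ d₂)         ≡⟨ [m*n]*[o*p]≡[m*o]*[n*p] c₁ (N ^ d₁) c₂ (N ^ d₂) ⟩
    (c₁ * c₂) * (N ^ d₁ * N ^ d₂)         ≡⟨ cong (c₁ * c₂ *_) (^-distribˡ-+-* N d₁ d₂) ⟨
    (c₁ * c₂) * N ^ (d₁ + d₂)             ∎
  where open ≤-Reasoning

loopᴾ : Fin 14 → Poly → Poly → Poly
loopᴾ f S M = (κ 1 ⊕ M) ⊗ (κ ∣ f ∣ ⊕ S)

leᴾ eqᴾ insideᴾ violatedᴾ admitsᴾ appendᴾ joinᴾ searchᴾ nextᴾ firstᴾ thinᴾ iterateᴾ mainᴾ : Poly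
productᴾ : Poly → Poly
leᴾ        = loopᴾ LE (κ 0) X
-- The first factor bounds the size of an encoded pair: a numeral `m` has size `1 + m * 2`, and
-- positions are below `N`.
eqᴾ        = (κ 1 ⊕ ((κ 1 ⊕ X ⊗ κ 2) ⊕ (κ 1 ⊕ X ⊗ κ 2))) ⊗ κ ∣ EQ ∣
insideᴾ    = κ ∣ INSIDE ∣ ⊕ (leᴾ ⊕ leᴾ)
violatedᴾ  = κ ∣ VIOLATED ∣ ⊕ (leᴾ ⊕ (insideᴾ ⊕ insideᴾ))
admitsᴾ    = loopᴾ ADMITS violatedᴾ X
appendᴾ    = loopᴾ APPEND (κ 0) X
joinᴾ      = κ ∣ JOIN ∣ ⊕ (appendᴾ ⊕ (eqᴾ ⊕ (eqᴾ ⊕ ((leᴾ ⊕ leᴾ) ⊕ admitsᴾ))))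
-- A table has at most `N * N` entries, so this is the number of pairs of entries.
searchᴾ    = loopᴾ SEARCH joinᴾ ((X ⊗ X) ⊗ (X ⊗ X))
nextᴾ      = loopᴾ NEXT searchᴾ (X ⊗ X)
productᴾ M = loopᴾ PRODUCT (loopᴾ ROW (κ 0) M) M
firstᴾ     = loopᴾ FIRST (κ 0) X
thinᴾ      = loopᴾ THIN (κ 0) X
iterateᴾ   = loopᴾ ITERATE (productᴾ (X ⊗ X) ⊕ nextᴾ ⊕ thinᴾ) X
mainᴾ      = κ (nodes (Program.main program)) ⊕ ((firstᴾ ⊕ productᴾ X) ⊕ iterateᴾ)

-- Running the functions

spine : Tree → ℕ
spine nil        = 0
spine (cons _ r) = suc (spine r)

spine-encodeℕ : ∀ m → spine (encodeℕ m) ≡ m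
spine-encodeℕ zero    = refl
spine-encodeℕ (suc m) = cong suc (spine-encodeℕ m)

spine-encodeList : (enc : A → Tree) (xs : List A) → spine (encodeList enc xs) ≡ length xs
spine-encodeList enc []       = refl
spine-encodeList enc (_ ∷ xs) = cong suc (spine-encodeList enc xs)

<ᵇ-suc : ∀ a m → (a <ᵇ suc m) ≡ (a ≤ᵇ m)
<ᵇ-suc zero    m = refl
<ᵇ-suc (suc a) m = refl

-- Only the spine of `y` is inspected, so a list serves as the unary numeral of its length;
-- `VIOLATED` compares a weight with a chain in this way.
run-LE : ∀ a y → Runs LE (encodeℕ a ∷ y ∷ []) (encodeBool (a ≤ᵇ spine y)) (loopTime ∣ LE ∣ 0 a)
run-LE zero    y          = ⟨body⟩ (⟨match-nil⟩ ⟨var⟩ ⟨nil⟩)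
run-LE (suc a) nil        = relax (+-monoʳ-≤ ∣ LE ∣ z≤n)
  (⟨body⟩ (⟨match-cons⟩ ⟨var⟩ (⟨match-nil⟩ ⟨var⟩ (⟨cons⟩ ⟨nil⟩ ⟨nil⟩))))
run-LE (suc a) (cons _ y) rewrite <ᵇ-suc a (spine y) =
  ⟨body⟩ (⟨match-cons⟩ ⟨var⟩ (⟨match-cons⟩ ⟨var⟩ (⟨call⟩ (⟨var⟩ ⟨∷⟩ ⟨var⟩ ⟨∷⟩ ⟨[]⟩) (run-LE a y))))

-- Each call uses up one node of `x`, whatever the size of `y`.
run-EQ : ∀ x y → Runs EQ (x ∷ y ∷ []) (encodeBool (does (x ≟ᵀ y))) (size x * ∣ EQ ∣)
run-EQ nil        nil        = ⟨body⟩ (⟨match-nil⟩ ⟨var⟩ (⟨match-nil⟩ ⟨var⟩ ⟨nil⟩))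
run-EQ nil        (cons _ _) = ⟨body⟩ (⟨match-nil⟩ ⟨var⟩ (⟨match-cons⟩ ⟨var⟩ (⟨cons⟩ ⟨nil⟩ ⟨nil⟩)))
run-EQ (cons _ _) nil        = relax (+-monoʳ-≤ ∣ EQ ∣ z≤n)
  (⟨body⟩ (⟨match-cons⟩ ⟨var⟩ (⟨match-nil⟩ ⟨var⟩ (⟨cons⟩ ⟨nil⟩ ⟨nil⟩))))
run-EQ (cons a b) (cons c d) =
  relax (+-monoʳ-≤ ∣ EQ ∣ (≤-reflexive (sym (*-distribʳ-+ ∣ EQ ∣ (size a) (size b)))))
  (⟨body⟩ (⟨match-cons⟩ ⟨var⟩ (⟨match-cons⟩ ⟨var⟩ (⟨and⟩ (does (a ≟ᵀ c))
    (⟨call⟩ (⟨var⟩ ⟨∷⟩ ⟨var⟩ ⟨∷⟩ ⟨[]⟩) (run-EQ a c))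
    (⟨call⟩ (⟨var⟩ ⟨∷⟩ ⟨var⟩ ⟨∷⟩ ⟨[]⟩) (run-EQ b d))))))

run-APPEND : ∀ (enc : A → Tree) xs ys →
             Runs APPEND (encodeList enc xs ∷ encodeList enc ys ∷ []) (encodeList enc (xs ++ ys))
                  (loopTime ∣ APPEND ∣ 0 (length xs))
run-APPEND enc []       ys = ⟨body⟩ (⟨match-nil⟩ ⟨var⟩ ⟨var⟩)
run-APPEND enc (x ∷ xs) ys = ⟨body⟩ (⟨match-cons⟩ ⟨var⟩ (⟨cons⟩ ⟨var⟩
  (⟨call⟩ (⟨var⟩ ⟨∷⟩ ⟨var⟩ ⟨∷⟩ ⟨[]⟩) (run-APPEND enc xs ys))))

encode× : (A → Tree) → (B → Tree) → A × B → Tree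
encode× f g (a , b) = cons (f a) (g b)

run-ROW : ∀ (f : A → Tree) (g : B → Tree) x ys zs →
          Runs ROW (f x ∷ encodeList g ys ∷ encodeList (encode× f g) zs ∷ [])
               (encodeList (encode× f g) (map (x ,_) ys ++ zs)) (loopTime ∣ ROW ∣ 0 (length ys))
run-ROW f g x []       zs = ⟨body⟩ (⟨match-nil⟩ ⟨var⟩ ⟨var⟩)
run-ROW f g x (y ∷ ys) zs = ⟨body⟩ (⟨match-cons⟩ ⟨var⟩ (⟨cons⟩ (⟨cons⟩ ⟨var⟩ ⟨var⟩)
  (⟨call⟩ (⟨var⟩ ⟨∷⟩ ⟨var⟩ ⟨∷⟩ ⟨var⟩ ⟨∷⟩ ⟨[]⟩) (run-ROW f g x ys zs))))

run-PRODUCT : ∀ (f : A → Tree) (g : B → Tree) xs ys →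
              Runs PRODUCT (encodeList f xs ∷ encodeList g ys ∷ [])
                   (encodeList (encode× f g) (cartesianProduct xs ys))
                   (loopTime ∣ PRODUCT ∣ (loopTime ∣ ROW ∣ 0 (length ys)) (length xs))
run-PRODUCT f g []       ys = ⟨body⟩ (⟨match-nil⟩ ⟨var⟩ ⟨nil⟩)
run-PRODUCT f g (x ∷ xs) ys = ⟨body⟩ (⟨match-cons⟩ ⟨var⟩ (weaken
  (≤-reflexive (trans (cong (_+ loopTime ∣ ROW ∣ 0 (length ys)) (+-identityʳ _))
                      (+-comm _ (loopTime ∣ ROW ∣ 0 (length ys)))))
  (⟨call⟩ (⟨var⟩ ⟨∷⟩ ⟨var⟩ ⟨∷⟩ ⟨call⟩ (⟨var⟩ ⟨∷⟩ ⟨var⟩ ⟨∷⟩ ⟨[]⟩) (run-PRODUCT f g xs ys) ⟨∷⟩ ⟨[]⟩)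
          (run-ROW f g x ys (cartesianProduct xs ys)))))

run-PRODUCT-≤ : ∀ (f : A → Tree) (xs : List A) M {N} → length xs ≤ ⟦ M ⟧ N →
                Runs PRODUCT (encodeList f xs ∷ encodeList f xs ∷ [])
                     (encodeList (encode× f f) (cartesianProduct xs xs)) (⟦ productᴾ M ⟧ N)
run-PRODUCT-≤ f xs M {N} xs≤ = relax
  (≤-trans (loopTime-≤ ∣ PRODUCT ∣ _ xs≤) (*-monoʳ-≤ (suc (⟦ M ⟧ N)) (+-monoʳ-≤ ∣ PRODUCT ∣ (loopTime-≤ ∣ ROW ∣ 0 xs≤))))
  (run-PRODUCT f f xs xs)

loopTime-mono : ∀ c s {m M} → m ≤ M → loopTime c s m ≤ loopTime c s M
loopTime-mono c s {M = zero}  z≤n       = ≤-refl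
loopTime-mono c s {M = suc M} z≤n       = m≤m+n c _
loopTime-mono c s             (s≤s m≤M) = +-monoʳ-≤ c (+-monoʳ-≤ s (loopTime-mono c s m≤M))

run-THIN : ∀ (enc : A → Tree) xs →
           Runs THIN (encodeList enc xs ∷ []) (encodeList enc (thin xs)) (loopTime ∣ THIN ∣ 0 (length xs))
run-THIN enc [] = ⟨body⟩ (⟨match-nil⟩ ⟨var⟩ ⟨nil⟩)
run-THIN enc (_ ∷ []) = relax (+-monoʳ-≤ ∣ THIN ∣ z≤n)
  (⟨body⟩ (⟨match-cons⟩ ⟨var⟩ (⟨cons⟩ ⟨var⟩ (⟨match-nil⟩ ⟨var⟩ ⟨nil⟩))))
run-THIN enc (_ ∷ _ ∷ []) = relax (+-monoʳ-≤ ∣ THIN ∣ z≤n)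
  (⟨body⟩ (⟨match-cons⟩ ⟨var⟩ (⟨cons⟩ ⟨var⟩ (⟨match-cons⟩ ⟨var⟩ (⟨match-nil⟩ ⟨var⟩ ⟨nil⟩)))))
run-THIN enc (_ ∷ _ ∷ _ ∷ []) = relax (+-monoʳ-≤ ∣ THIN ∣ z≤n)
  (⟨body⟩ (⟨match-cons⟩ ⟨var⟩ (⟨cons⟩ ⟨var⟩ (⟨match-cons⟩ ⟨var⟩ (⟨match-cons⟩ ⟨var⟩ (⟨match-nil⟩ ⟨var⟩ ⟨nil⟩))))))
run-THIN enc (_ ∷ _ ∷ _ ∷ _ ∷ xs) = relax (+-monoʳ-≤ ∣ THIN ∣ (loopTime-mono ∣ THIN ∣ 0 (m≤n+m (length xs) 3)))
  (⟨body⟩ (⟨match-cons⟩ ⟨var⟩ (⟨cons⟩ ⟨var⟩ (⟨match-cons⟩ ⟨var⟩ (⟨match-cons⟩ ⟨var⟩ (⟨match-cons⟩ ⟨var⟩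
    (⟨call⟩ (⟨var⟩ ⟨∷⟩ ⟨[]⟩) (run-THIN enc xs))))))))

encodeEntry : Entry n n′ → Tree
encodeEntry = encode× encodeSolution (encode× encodePair encodePair)

-- `just` needs no tag, since an encoded entry is never `nil`.
encodeMaybe : Maybe (Entry n n′) → Tree
encodeMaybe nothing  = nil
encodeMaybe (just e) = encodeEntry e
size-encodeℕ : ∀ m → size (encodeℕ m) ≡ suc (m * 2)
size-encodeℕ zero    = refl
size-encodeℕ (suc m) = cong (2 +_) (size-encodeℕ m)

-- The closing `nil` makes the inequality strict.
length<size : ∀ (enc : A → Tree) xs → length xs < size (encodeList enc xs)
length<size enc []       = s≤s z≤n
length<size enc (x ∷ xs) = s≤s (≤-trans (length<size enc xs) (m≤n+m _ (size (enc x))))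

kind : Constraint n n′ → ℕ
kind (type₁ _ _ _) = 1
kind (type₂ _ _ _) = 2
kind (type₃ _ _ _) = 3
kind (type₄ _ _ _) = 4

vertexᵃ vertexᵇ : Constraint n n′ → Tree
vertexᵃ (type₁ a _ _) = encodeFin a
vertexᵃ (type₂ a _ _) = encodeFin a
vertexᵃ (type₃ a _ _) = encodeFin a
vertexᵃ (type₄ a _ _) = encodeFin a
vertexᵇ (type₁ _ b _) = encodeFin b
vertexᵇ (type₂ _ b _) = encodeFin b
vertexᵇ (type₃ _ b _) = encodeFin b
vertexᵇ (type₄ _ b _) = encodeFin b

-- `VIOLATED` takes the quadruple apart in the same way for all types and leaves the dispatch to
-- `INSIDE`; its proof can thus avoid four cases.
encodeConstraint-quadruple : (K : Constraint n n′) →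
  encodeConstraint K ≡ encodeQuadruple (kind K) (vertexᵃ K) (vertexᵇ K) (weight K)
encodeConstraint-quadruple (type₁ _ _ _) = refl
encodeConstraint-quadruple (type₂ _ _ _) = refl
encodeConstraint-quadruple (type₃ _ _ _) = refl
encodeConstraint-quadruple (type₄ _ _ _) = refl

length-cartesianProduct : (xs : List A) (ys : List B) → length (cartesianProduct xs ys) ≡ length xs * length ys
length-cartesianProduct []       ys = refl
length-cartesianProduct (x ∷ xs) ys = trans (length-++ (map (x ,_) ys))
  (cong₂ _+_ (length-map (x ,_) ys) (length-cartesianProduct xs ys))

n<2^n : ∀ j → j < 2 ^ j
n<2^n zero    = s≤s z≤n
n<2^n (suc j) = ≤-trans (s≤s (n<2^n j)) (^-monoʳ-< 2 (s≤s (s≤s z≤n)) (n<1+n j))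

⟨choose⟩ : ∀ {k C} {ρ : Vec Tree k} {e e₁} b (x : Entry n n′) →
           Eval ρ e (encodeBool b) C → Eval ρ e₁ (encodeEntry x) 0 →
           Eval ρ (match e e₁ nil) (encodeMaybe (if b then just x else nothing)) C
⟨choose⟩ {C = C} true  x E E₁ = weaken (≤-reflexive (+-identityʳ C)) (⟨match-nil⟩ E E₁)
⟨choose⟩ {C = C} false x E E₁ = weaken (≤-reflexive (+-identityʳ C)) (⟨match-cons⟩ E ⟨nil⟩)

-- The budget of a round covers product, next table, thinning and the remaining rounds. The last
-- round thins and does not continue; `full-round` treats the others, which continue without
-- thinning.
last-round : ∀ a b c d → ((a + 0) + b) + c ≤ ((a + b) + c) + d
last-round a b c d rewrite +-identityʳ a = m≤m+n (a + b + c) d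

full-round : ∀ a b c d → ((a + 0) + b) + d ≤ ((a + b) + c) + d
full-round a b c d rewrite +-identityʳ a = +-monoˡ-≤ d (m≤m+n (a + b) c)

-- Correctness and running time on one instance

module Running (I : Instance) (N : ℕ) (∣σ∣≤N : Instance.n I ≤ N) (∣σ′∣≤N : Instance.n′ I ≤ N)
               (∣D∣<N : length (Instance.demands I) < N) (∣Ks∣≤N : length (Instance.constraints I) ≤ N) where
  open Instance I renaming (n to ∣σ∣; n′ to ∣σ′∣; demands to D; constraints to Ks)
  open Blocks D Ks
  open Tables D Ks
  open IsTable

  -- Strict, because `VIOLATED` calls `LE` on the successor of the weight, and the weight may equal
  -- the number of demands.
  weights<N : All (λ K → weight K < N) Ks
  weights<N = All.map (λ {K} adm → ≤-<-trans (admissible⇒weight≤ K adm) ∣D∣<N) admissible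

  run-LE-tree : ∀ a y → a ≤ N → Runs LE (encodeℕ a ∷ y ∷ []) (encodeBool (a ≤ᵇ spine y)) (⟦ leᴾ ⟧ N)
  run-LE-tree a y a≤N = relax (loopTime-≤ ∣ LE ∣ 0 a≤N) (run-LE a y)

  run-LE-ℕ : ∀ a b → a ≤ N → Runs LE (encodeℕ a ∷ encodeℕ b ∷ []) (encodeBool (a ≤ᵇ b)) (⟦ leᴾ ⟧ N)
  run-LE-ℕ a b a≤N = subst (λ m → Runs LE (encodeℕ a ∷ encodeℕ b ∷ []) (encodeBool (a ≤ᵇ m)) (⟦ leᴾ ⟧ N))
    (spine-encodeℕ b) (run-LE-tree a (encodeℕ b) a≤N)

  σ<N : (s : Fin ∣σ∣) → position s < N
  σ<N s = <-≤-trans (toℕ<n s) ∣σ∣≤N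

  σ′<N : (t : Fin ∣σ′∣) → position t < N
  σ′<N t = <-≤-trans (toℕ<n t) ∣σ′∣≤N

  private
    le-σ : ∀ (a : Fin ∣σ∣) {m} (b : Fin m) →
           Runs LE (encodeFin a ∷ encodeFin b ∷ []) (encodeBool (position a ≤ᵇ position b)) (⟦ leᴾ ⟧ N)
    le-σ a b = run-LE-ℕ (position a) (position b) (<⇒≤ (σ<N a))

    le-σ′ : ∀ (a : Fin ∣σ′∣) {m} (b : Fin m) →
            Runs LE (encodeFin a ∷ encodeFin b ∷ []) (encodeBool (position a ≤ᵇ position b)) (⟦ leᴾ ⟧ N)
    le-σ′ a b = run-LE-ℕ (position a) (position b) (<⇒≤ (σ′<N a))

  run-INSIDE : ∀ (K : Constraint ∣σ∣ ∣σ′∣) p →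
               Runs INSIDE (encodeℕ (kind K) ∷ vertexᵃ K ∷ vertexᵇ K ∷ encodePair p ∷ [])
                    (encodeBool (does (inside? K p))) (⟦ insideᴾ ⟧ N)
  run-INSIDE (type₁ a b _) (s , t) = ⟨body⟩ (⟨match-cons⟩ ⟨var⟩ (⟨match-cons⟩ ⟨var⟩ (⟨match-nil⟩ ⟨var⟩
    (⟨and⟩ (position a ≤ᵇ position s) (⟨call⟩ (⟨var⟩ ⟨∷⟩ ⟨var⟩ ⟨∷⟩ ⟨[]⟩) (le-σ a s))
                                      (⟨call⟩ (⟨var⟩ ⟨∷⟩ ⟨var⟩ ⟨∷⟩ ⟨[]⟩) (le-σ s b))))))
  run-INSIDE (type₂ a b _) (s , t) = ⟨body⟩ (⟨match-cons⟩ ⟨var⟩ (⟨match-cons⟩ ⟨var⟩ (⟨match-cons⟩ ⟨var⟩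
    (⟨match-nil⟩ ⟨var⟩
    (⟨and⟩ (position a ≤ᵇ position t) (⟨call⟩ (⟨var⟩ ⟨∷⟩ ⟨var⟩ ⟨∷⟩ ⟨[]⟩) (le-σ′ a t))
                                      (⟨call⟩ (⟨var⟩ ⟨∷⟩ ⟨var⟩ ⟨∷⟩ ⟨[]⟩) (le-σ′ t b)))))))
  run-INSIDE (type₃ a b _) (s , t) = ⟨body⟩ (⟨match-cons⟩ ⟨var⟩ (⟨match-cons⟩ ⟨var⟩ (⟨match-cons⟩ ⟨var⟩
    (⟨match-cons⟩ ⟨var⟩ (⟨match-nil⟩ ⟨var⟩
    (⟨and⟩ (position s ≤ᵇ position a) (⟨call⟩ (⟨var⟩ ⟨∷⟩ ⟨var⟩ ⟨∷⟩ ⟨[]⟩) (le-σ s a))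
                                      (⟨call⟩ (⟨var⟩ ⟨∷⟩ ⟨var⟩ ⟨∷⟩ ⟨[]⟩) (le-σ′ b t))))))))
  run-INSIDE (type₄ a b _) (s , t) = ⟨body⟩ (⟨match-cons⟩ ⟨var⟩ (⟨match-cons⟩ ⟨var⟩ (⟨match-cons⟩ ⟨var⟩
    (⟨match-cons⟩ ⟨var⟩ (⟨match-cons⟩ ⟨var⟩
    (⟨and⟩ (position a ≤ᵇ position s) (⟨call⟩ (⟨var⟩ ⟨∷⟩ ⟨var⟩ ⟨∷⟩ ⟨[]⟩) (le-σ a s))
                                      (⟨call⟩ (⟨var⟩ ⟨∷⟩ ⟨var⟩ ⟨∷⟩ ⟨[]⟩) (le-σ′ t b))))))))

  run-VIOLATED : ∀ (K : Constraint ∣σ∣ ∣σ′∣) p q (c : List (Pair ∣σ∣ ∣σ′∣)) → weight K < N →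
                 Runs VIOLATED (encodeConstraint K ∷ encodePair p ∷ encodePair q ∷ encodeSolution c ∷ [])
                      (encodeBool (does (violated? (length c) p q K))) (⟦ violatedᴾ ⟧ N)
  run-VIOLATED K p q c w<N rewrite encodeConstraint-quadruple K =
    ⟨body⟩ (⟨match-cons⟩ ⟨var⟩ (⟨match-cons⟩ ⟨var⟩ (⟨match-cons⟩ ⟨var⟩
      (⟨and⟩ (weight K <ᵇ length c) (⟨call⟩ (⟨cons⟩ ⟨nil⟩ ⟨var⟩ ⟨∷⟩ ⟨var⟩ ⟨∷⟩ ⟨[]⟩) less)
      (⟨and⟩ (does (inside? K p))
        (⟨call⟩ (⟨var⟩ ⟨∷⟩ ⟨var⟩ ⟨∷⟩ ⟨var⟩ ⟨∷⟩ ⟨var⟩ ⟨∷⟩ ⟨[]⟩) (run-INSIDE K p))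
        (⟨call⟩ (⟨var⟩ ⟨∷⟩ ⟨var⟩ ⟨∷⟩ ⟨var⟩ ⟨∷⟩ ⟨var⟩ ⟨∷⟩ ⟨[]⟩) (run-INSIDE K q)))))))
    where
    less : Runs LE (encodeℕ (suc (weight K)) ∷ encodeSolution c ∷ []) (encodeBool (weight K <ᵇ length c)) (⟦ leᴾ ⟧ N)
    less = subst (λ m → Runs LE (encodeℕ (suc (weight K)) ∷ encodeSolution c ∷ []) (encodeBool (weight K <ᵇ m)) (⟦ leᴾ ⟧ N))
      (spine-encodeList encodePair c) (run-LE-tree (suc (weight K)) (encodeSolution c) w<N)

  run-ADMITS : ∀ (p q : Pair ∣σ∣ ∣σ′∣) (c : List (Pair ∣σ∣ ∣σ′∣)) Js → All (λ K → weight K < N) Js →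
               Runs ADMITS (encodePair p ∷ encodePair q ∷ encodeSolution c ∷ encodeList encodeConstraint Js ∷ [])
                    (encodeBool (does (Blocks.admits? D Js (length c) p q)))
                    (loopTime ∣ ADMITS ∣ (⟦ violatedᴾ ⟧ N) (length Js))
  run-ADMITS p q c []       _          = ⟨body⟩ (⟨match-nil⟩ ⟨var⟩ ⟨nil⟩)
  -- `admits?` on `K ∷ Js` computes to a conjunction starting with the negated verdict on `K`, so
  -- splitting on that Boolean follows the program. A violation ends the loop early.
  run-ADMITS p q c (K ∷ Js) (w< ∷ ws<) = by-cases (does (violated? (length c) p q K)) (run-VIOLATED K p q c w<)
    where
    by-cases : ∀ b → Runs VIOLATED (encodeConstraint K ∷ encodePair p ∷ encodePair q ∷ encodeSolution c ∷ [])
                          (encodeBool b) (⟦ violatedᴾ ⟧ N) →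
               Runs ADMITS (encodePair p ∷ encodePair q ∷ encodeSolution c ∷ encodeList encodeConstraint (K ∷ Js) ∷ [])
                    (encodeBool (not b ∧ does (Blocks.admits? D Js (length c) p q)))
                    (loopTime ∣ ADMITS ∣ (⟦ violatedᴾ ⟧ N) (length (K ∷ Js)))
    by-cases true  R = ⟨body⟩ (⟨match-cons⟩ ⟨var⟩ (weaken (+-monoʳ-≤ (⟦ violatedᴾ ⟧ N) z≤n)
      (⟨match-nil⟩ (⟨call⟩ (⟨var⟩ ⟨∷⟩ ⟨var⟩ ⟨∷⟩ ⟨var⟩ ⟨∷⟩ ⟨var⟩ ⟨∷⟩ ⟨[]⟩) R) (⟨cons⟩ ⟨nil⟩ ⟨nil⟩))))
    by-cases false R = ⟨body⟩ (⟨match-cons⟩ ⟨var⟩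
      (⟨match-cons⟩ (⟨call⟩ (⟨var⟩ ⟨∷⟩ ⟨var⟩ ⟨∷⟩ ⟨var⟩ ⟨∷⟩ ⟨var⟩ ⟨∷⟩ ⟨[]⟩) R)
        (⟨call⟩ (⟨var⟩ ⟨∷⟩ ⟨var⟩ ⟨∷⟩ ⟨var⟩ ⟨∷⟩ ⟨var⟩ ⟨∷⟩ ⟨[]⟩) (run-ADMITS p q c Js ws<))))

  run-EQ-pair : (p q : Pair ∣σ∣ ∣σ′∣) →
                Runs EQ (encodePair p ∷ encodePair q ∷ []) (encodeBool (does (p ≟ᴾ q))) (⟦ eqᴾ ⟧ N)
  run-EQ-pair p@(s , t) q = relax (*-monoˡ-≤ ∣ EQ ∣ (s≤s (+-mono-≤ (small s (σ<N s)) (small t (σ′<N t)))))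
    (run-EQ (encodePair p) (encodePair q))
    where
    small : ∀ {m} (i : Fin m) → position i < N → size (encodeFin i) ≤ 1 + N * 2
    small i i< = subst (_≤ 1 + N * 2) (sym (size-encodeℕ (position i))) (s≤s (*-monoˡ-≤ 2 (<⇒≤ i<)))

  -- `APPEND` recurses on its first argument, so only the left chain affects its running time.
  Short : Entry ∣σ∣ ∣σ′∣ × Entry ∣σ∣ ∣σ′∣ → Set
  Short ((c , _) , _) = length c ≤ N

  encodePQ : Pair ∣σ∣ ∣σ′∣ × Pair ∣σ∣ ∣σ′∣ → Tree
  encodePQ = encode× encodePair encodePair

  encodeEF : Entry ∣σ∣ ∣σ′∣ × Entry ∣σ∣ ∣σ′∣ → Tree
  encodeEF = encode× encodeEntry encodeEntry

  run-JOIN : ∀ pq ef → Short ef →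
             Runs JOIN (encodePQ pq ∷ encodeEF ef ∷ encodeList encodeConstraint Ks ∷ [])
                  (encodeMaybe (orElse (joinable? pq ef) (join pq ef) nothing)) (⟦ joinᴾ ⟧ N)
  run-JOIN pq@(p , q) ef@((c , p₀ , p′@(s , t)) , (d , q′@(s′ , t′) , q₀)) short =
    ⟨body⟩ (⟨match-cons⟩ ⟨var⟩ (⟨match-cons⟩ ⟨var⟩ (⟨match-cons⟩ ⟨var⟩ (⟨match-cons⟩ ⟨var⟩
           (⟨match-cons⟩ ⟨var⟩ (⟨match-cons⟩ ⟨var⟩ (⟨match-cons⟩ ⟨var⟩ (⟨match-cons⟩ ⟨var⟩
           (⟨bind⟩ (⟨call⟩ (⟨var⟩ ⟨∷⟩ ⟨var⟩ ⟨∷⟩ ⟨[]⟩) (relax (loopTime-≤ ∣ APPEND ∣ 0 short) (run-APPEND encodePair c d)))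
           (⟨choose⟩ (does (joinable? pq ef)) (join pq ef)
             (⟨and⟩ (does (p₀ ≟ᴾ p)) (⟨call⟩ (⟨var⟩ ⟨∷⟩ ⟨var⟩ ⟨∷⟩ ⟨[]⟩) (run-EQ-pair p₀ p))
             (⟨and⟩ (does (q₀ ≟ᴾ q)) (⟨call⟩ (⟨var⟩ ⟨∷⟩ ⟨var⟩ ⟨∷⟩ ⟨[]⟩) (run-EQ-pair q₀ q))
             (⟨and⟩ ((position s <ᵇ position s′) ∧ (position t <ᵇ position t′))
               (⟨and⟩ (position s <ᵇ position s′)
                 (⟨call⟩ (⟨cons⟩ ⟨nil⟩ ⟨var⟩ ⟨∷⟩ ⟨var⟩ ⟨∷⟩ ⟨[]⟩) (run-LE-ℕ (suc (position s)) (position s′) (σ<N s)))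
                 (⟨call⟩ (⟨cons⟩ ⟨nil⟩ ⟨var⟩ ⟨∷⟩ ⟨var⟩ ⟨∷⟩ ⟨[]⟩) (run-LE-ℕ (suc (position t)) (position t′) (σ′<N t))))
               (⟨call⟩ (⟨var⟩ ⟨∷⟩ ⟨var⟩ ⟨∷⟩ ⟨var⟩ ⟨∷⟩ ⟨var⟩ ⟨∷⟩ ⟨[]⟩)
                 (relax (loopTime-≤ ∣ ADMITS ∣ (⟦ violatedᴾ ⟧ N) {M = N} ∣Ks∣≤N) (run-ADMITS p q (c ++ d) Ks weights<N))))))
             (⟨cons⟩ ⟨var⟩ ⟨var⟩)))))))))))

  run-SEARCH : ∀ pq efs → All Short efs →
               Runs SEARCH (encodePQ pq ∷ encodeList encodeEF efs ∷ encodeList encodeConstraint Ks ∷ [])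
                    (encodeMaybe (search pq efs)) (loopTime ∣ SEARCH ∣ (⟦ joinᴾ ⟧ N) (length efs))
  run-SEARCH pq []         _              = ⟨body⟩ (⟨match-nil⟩ ⟨var⟩ ⟨nil⟩)
  run-SEARCH pq (ef ∷ efs) (short ∷ rest) = by-cases (does (joinable? pq ef)) (run-JOIN pq ef short)
    where
    by-cases : ∀ b → Runs JOIN (encodePQ pq ∷ encodeEF ef ∷ encodeList encodeConstraint Ks ∷ [])
                          (encodeMaybe (if b then just (join pq ef) else nothing)) (⟦ joinᴾ ⟧ N) →
               Runs SEARCH (encodePQ pq ∷ encodeList encodeEF (ef ∷ efs) ∷ encodeList encodeConstraint Ks ∷ [])
                    (encodeMaybe (if b then just (join pq ef) else search pq efs))
                    (loopTime ∣ SEARCH ∣ (⟦ joinᴾ ⟧ N) (length (ef ∷ efs)))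
    by-cases true  R = ⟨body⟩ (⟨match-cons⟩ ⟨var⟩ (weaken (+-monoʳ-≤ (⟦ joinᴾ ⟧ N) z≤n)
      (⟨match-cons⟩ (⟨call⟩ (⟨var⟩ ⟨∷⟩ ⟨var⟩ ⟨∷⟩ ⟨var⟩ ⟨∷⟩ ⟨[]⟩) R) (⟨cons⟩ ⟨var⟩ ⟨var⟩))))
    by-cases false R = ⟨body⟩ (⟨match-cons⟩ ⟨var⟩
      (⟨match-nil⟩ (⟨call⟩ (⟨var⟩ ⟨∷⟩ ⟨var⟩ ⟨∷⟩ ⟨var⟩ ⟨∷⟩ ⟨[]⟩) R)
        (⟨call⟩ (⟨var⟩ ⟨∷⟩ ⟨var⟩ ⟨∷⟩ ⟨var⟩ ⟨∷⟩ ⟨[]⟩) (run-SEARCH pq efs rest))))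

  run-NEXT : ∀ pqs efs → All Short efs → length efs ≤ (N * N) * (N * N) →
             Runs NEXT (encodeList encodePQ pqs ∷ encodeList encodeEF efs ∷ encodeList encodeConstraint Ks ∷ [])
                  (encodeList encodeEntry (nextTable pqs efs)) (loopTime ∣ NEXT ∣ (⟦ searchᴾ ⟧ N) (length pqs))
  run-NEXT []         efs short efs≤ = ⟨body⟩ (⟨match-nil⟩ ⟨var⟩ ⟨nil⟩)
  run-NEXT (pq ∷ pqs) efs short efs≤ = by-cases (search pq efs)
      (relax (loopTime-≤ ∣ SEARCH ∣ (⟦ joinᴾ ⟧ N) {M = (N * N) * (N * N)} efs≤) (run-SEARCH pq efs short))
    where
    by-cases : ∀ m → Runs SEARCH (encodePQ pq ∷ encodeList encodeEF efs ∷ encodeList encodeConstraint Ks ∷ [])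
                          (encodeMaybe m) (⟦ searchᴾ ⟧ N) →
               Runs NEXT (encodeList encodePQ (pq ∷ pqs) ∷ encodeList encodeEF efs ∷ encodeList encodeConstraint Ks ∷ [])
                    (encodeList encodeEntry (maybe′ _∷_ id m (nextTable pqs efs)))
                    (loopTime ∣ NEXT ∣ (⟦ searchᴾ ⟧ N) (length (pq ∷ pqs)))
    by-cases nothing  R = ⟨body⟩ (⟨match-cons⟩ ⟨var⟩
      (⟨match-nil⟩ (⟨call⟩ (⟨var⟩ ⟨∷⟩ ⟨var⟩ ⟨∷⟩ ⟨var⟩ ⟨∷⟩ ⟨[]⟩) R)
        (⟨call⟩ (⟨var⟩ ⟨∷⟩ ⟨var⟩ ⟨∷⟩ ⟨var⟩ ⟨∷⟩ ⟨[]⟩) (run-NEXT pqs efs short efs≤))))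
    by-cases (just _) R = ⟨body⟩ (⟨match-cons⟩ ⟨var⟩
      (⟨match-cons⟩ (⟨call⟩ (⟨var⟩ ⟨∷⟩ ⟨var⟩ ⟨∷⟩ ⟨var⟩ ⟨∷⟩ ⟨[]⟩) R)
        (⟨cons⟩ (⟨cons⟩ ⟨var⟩ ⟨var⟩)
          (⟨call⟩ (⟨var⟩ ⟨∷⟩ ⟨var⟩ ⟨∷⟩ ⟨var⟩ ⟨∷⟩ ⟨[]⟩) (run-NEXT pqs efs short efs≤)))))

  run-FIRST : ∀ ps → Runs FIRST (encodeList encodePair ps ∷ []) (encodeList encodeEntry (firstTable ps))
                          (loopTime ∣ FIRST ∣ 0 (length ps))
  run-FIRST []       = ⟨body⟩ (⟨match-nil⟩ ⟨var⟩ ⟨nil⟩)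
  run-FIRST (p ∷ ps) = ⟨body⟩ (⟨match-cons⟩ ⟨var⟩
    (⟨cons⟩ (⟨cons⟩ (⟨cons⟩ ⟨var⟩ ⟨nil⟩) (⟨cons⟩ ⟨var⟩ ⟨var⟩)) (⟨call⟩ (⟨var⟩ ⟨∷⟩ ⟨[]⟩) (run-FIRST ps))))

  Approximates : List (Pair ∣σ∣ ∣σ′∣) → Set
  Approximates M = Feasible I M × (∀ {O} → Feasible I O → length O ≤ 8 * length M)

  private
    DD = cartesianProduct D D

    ∣DD∣≤ : length DD ≤ N * N
    ∣DD∣≤ = subst (_≤ N * N) (sym (length-cartesianProduct D D)) (*-mono-≤ (<⇒≤ ∣D∣<N) (<⇒≤ ∣D∣<N))

    roundᴾ : Poly
    roundᴾ = productᴾ (X ⊗ X) ⊕ nextᴾ ⊕ thinᴾ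

  -- A block at level j has 2 ^ j > j elements, so level n is never reached.
  run-ITERATE : ∀ fuel j e T → IsTable j (e ∷ T) → length (e ∷ T) ≤ N * N → ∣σ∣ ≤ j + fuel →
                ∃[ M ] (Runs ITERATE (encodeList encodeEntry (e ∷ T) ∷ encodeList encodePQ DD
                                       ∷ encodeList encodeConstraint Ks ∷ [])
                             (encodeSolution M) (loopTime ∣ ITERATE ∣ (⟦ roundᴾ ⟧ N) fuel)
                        × Approximates M)
  run-ITERATE zero j e@(c , p , q) T t T≤ n≤ =
    contradiction (subst (_≤ ∣σ∣) (block-length b) (chain-length≤ (block-chain b)))
      (<⇒≱ (≤-<-trans (subst (∣σ∣ ≤_) (+-identityʳ j) n≤) (n<2^n j)))
    where b = sound t (here refl)
  run-ITERATE (suc fuel) j e@(c , p , q) T t T≤ n≤ =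
    continue (nextTable DD TT) (nextTable-isTable t) (≤-trans (length-nextTable DD TT) ∣DD∣≤)
      (relax (loopTime-≤ ∣ NEXT ∣ (⟦ searchᴾ ⟧ N) {M = N * N} ∣DD∣≤) (run-NEXT DD TT short TT≤))
    where
    TT = cartesianProduct (e ∷ T) (e ∷ T)
    b = sound t (here refl)

    entry-short : ∀ {f} → f ∈ e ∷ T → length (proj₁ f) ≤ N
    entry-short f∈ = ≤-trans (chain-length≤ (block-chain (sound t f∈))) ∣σ∣≤N

    short : All Short TT
    short = All.tabulate (λ ef∈ → entry-short (proj₁ (∈-cartesianProduct⁻ (e ∷ T) (e ∷ T) ef∈)))

    TT≤ : length TT ≤ (N * N) * (N * N)
    TT≤ = subst (_≤ (N * N) * (N * N)) (sym (length-cartesianProduct (e ∷ T) (e ∷ T))) (*-mono-≤ T≤ T≤)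

    continue : ∀ U → IsTable (suc j) U → length U ≤ N * N →
               Runs NEXT (encodeList encodePQ DD ∷ encodeList encodeEF TT ∷ encodeList encodeConstraint Ks ∷ [])
                    (encodeList encodeEntry U) (⟦ nextᴾ ⟧ N) →
               ∃[ M ] (Runs ITERATE (encodeList encodeEntry (e ∷ T) ∷ encodeList encodePQ DD
                                      ∷ encodeList encodeConstraint Ks ∷ [])
                            (encodeSolution M) (loopTime ∣ ITERATE ∣ (⟦ roundᴾ ⟧ N) (suc fuel))
                       × Approximates M)
    -- An empty next table makes the current level the largest, and any of its blocks gives the
    -- ratio; the head entry is taken.
    continue [] u U≤ R = thin c ,
      relax (+-monoʳ-≤ ∣ ITERATE ∣ (last-round (⟦ productᴾ (X ⊗ X) ⟧ N) (⟦ nextᴾ ⟧ N) (⟦ thinᴾ ⟧ N) _))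
        (⟨body⟩ (⟨match-cons⟩ ⟨var⟩ (⟨bind⟩
        (⟨call⟩ (⟨var⟩ ⟨∷⟩ ⟨call⟩ (⟨var⟩ ⟨∷⟩ ⟨var⟩ ⟨∷⟩ ⟨[]⟩) (run-PRODUCT-≤ encodeEntry (e ∷ T) (X ⊗ X) {N} T≤) ⟨∷⟩ ⟨var⟩ ⟨∷⟩ ⟨[]⟩) R)
        (⟨match-nil⟩ ⟨var⟩ (⟨match-cons⟩ ⟨var⟩ (⟨call⟩ (⟨var⟩ ⟨∷⟩ ⟨[]⟩)
          (relax (loopTime-≤ ∣ THIN ∣ 0 (entry-short (here refl))) (run-THIN encodePair c)))))))) ,
      thin-block-feasible I b , thin-block-approximates I u b
    continue (f ∷ U) u U≤ R with run-ITERATE fuel (suc j) f U u U≤ (subst (∣σ∣ ≤_) (+-suc j fuel) n≤)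
    ... | M , R′ , good = M ,
      relax (+-monoʳ-≤ ∣ ITERATE ∣ (full-round (⟦ productᴾ (X ⊗ X) ⟧ N) (⟦ nextᴾ ⟧ N) (⟦ thinᴾ ⟧ N) _))
        (⟨body⟩ (⟨match-cons⟩ ⟨var⟩ (⟨bind⟩
        (⟨call⟩ (⟨var⟩ ⟨∷⟩ ⟨call⟩ (⟨var⟩ ⟨∷⟩ ⟨var⟩ ⟨∷⟩ ⟨[]⟩) (run-PRODUCT-≤ encodeEntry (e ∷ T) (X ⊗ X) {N} T≤) ⟨∷⟩ ⟨var⟩ ⟨∷⟩ ⟨[]⟩) R)
        (⟨match-cons⟩ ⟨var⟩ (⟨call⟩ (⟨var⟩ ⟨∷⟩ ⟨var⟩ ⟨∷⟩ ⟨var⟩ ⟨∷⟩ ⟨[]⟩) R′))))) ,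
      good

  start : ∀ T → IsTable 0 T → length T ≤ N * N →
          ∃[ M ] (Runs ITERATE (encodeList encodeEntry T ∷ encodeList encodePQ DD
                                 ∷ encodeList encodeConstraint Ks ∷ [])
                       (encodeSolution M) (⟦ iterateᴾ ⟧ N)
                  × Approximates M)
  start [] t T≤ = [] ,
    relax (loopTime-≤ ∣ ITERATE ∣ (⟦ roundᴾ ⟧ N) {M = N} z≤n) (⟨body⟩ (⟨match-nil⟩ ⟨var⟩ ⟨nil⟩)) ,
    -- An empty table of level 0 forces every feasible solution to have fewer than `2 ^ 0 = 1`
    -- elements.
    []-feasible I , λ feas → s≤s⁻¹ (feasible-length< I t feas)
  start (e ∷ T) t T≤ with run-ITERATE ∣σ∣ 0 e T t T≤ ≤-refl
  ... | M , R , good = M , relax (loopTime-≤ ∣ ITERATE ∣ (⟦ roundᴾ ⟧ N) {M = N} ∣σ∣≤N) R , good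

  run-main : ∃[ M ] ∃[ t ] (Run program (encodeInstance I) (encodeSolution M) t
                             × t ≤ ⟦ mainᴾ ⟧ N × Approximates M)
  run-main with start (firstTable D) firstTable-isTable
                  (≤-trans (≤-reflexive (trans (length-map _ D) (sym (*-identityˡ (length D))))) (*-mono-≤ (≤-trans (s≤s z≤n) ∣D∣<N) (<⇒≤ ∣D∣<N)))
  ... | M , R , good = M , Eval.time main-eval , Eval.evaluation main-eval , Eval.bound main-eval , good
    where
    main-eval : Eval (encodeInstance I ∷ []) (Program.main program) (encodeSolution M)
                     ((⟦ firstᴾ ⟧ N + ⟦ productᴾ X ⟧ N) + ⟦ iterateᴾ ⟧ N)
    main-eval = ⟨match-cons⟩ ⟨var⟩ (⟨match-cons⟩ ⟨var⟩ (⟨match-cons⟩ ⟨var⟩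
      (weaken (≤-reflexive (cong (λ m → (⟦ firstᴾ ⟧ N + m) + ⟦ iterateᴾ ⟧ N) (+-identityʳ (⟦ productᴾ X ⟧ N))))
      (⟨call⟩
        (⟨call⟩ (⟨var⟩ ⟨∷⟩ ⟨[]⟩) (relax (loopTime-≤ ∣ FIRST ∣ 0 {M = N} (<⇒≤ ∣D∣<N)) (run-FIRST D))
          ⟨∷⟩ ⟨call⟩ (⟨var⟩ ⟨∷⟩ ⟨var⟩ ⟨∷⟩ ⟨[]⟩) (run-PRODUCT-≤ encodePair D X {N} (<⇒≤ ∣D∣<N))
          ⟨∷⟩ ⟨var⟩ ⟨∷⟩ ⟨[]⟩)
        R))))

-- From instance parameters to input size

module _ (I : Instance) where
  open Instance I

  private
    nᵀ n′ᵀ Dᵀ Kᵀ : Tree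
    nᵀ  = encodeℕ (Instance.n I)
    n′ᵀ = encodeℕ (Instance.n′ I)
    Dᵀ  = encodeList encodePair demands
    Kᵀ  = encodeList encodeConstraint constraints

    tail≤ : ∀ l r → size r ≤ size (cons l r)
    tail≤ l r = m≤n+m (size r) (suc (size l))

    head≤ : ∀ l r → size l ≤ size (cons l r)
    head≤ l r = m≤n⇒m≤1+n (m≤m+n (size l) (size r))

    value≤size : ∀ m → m ≤ size (encodeℕ m)
    value≤size m = subst (m ≤_) (sym (size-encodeℕ m)) (m≤n⇒m≤1+n (m≤m*n m 2))

    lists≤ : size (cons Dᵀ Kᵀ) ≤ size (encodeInstance I)
    lists≤ = ≤-trans (tail≤ n′ᵀ (cons Dᵀ Kᵀ)) (tail≤ nᵀ (cons n′ᵀ (cons Dᵀ Kᵀ)))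

  run-program : ∃[ M ] ∃[ t ] (Run program (encodeInstance I) (encodeSolution M) t
                  × t ≤ ⟦ mainᴾ ⟧ (size (encodeInstance I))
                  × Feasible I M × (∀ {O} → Feasible I O → length O ≤ 8 * length M))
  run-program = Running.run-main I (size (encodeInstance I))
    (≤-trans (value≤size _) (head≤ nᵀ (cons n′ᵀ (cons Dᵀ Kᵀ))))
    (≤-trans (value≤size _) (≤-trans (head≤ n′ᵀ (cons Dᵀ Kᵀ)) (tail≤ nᵀ (cons n′ᵀ (cons Dᵀ Kᵀ)))))
    (≤-trans (length<size encodePair demands) (≤-trans (head≤ Dᵀ Kᵀ) lists≤))
    (≤-trans (<⇒≤ (length<size encodeConstraint constraints)) (≤-trans (tail≤ Dᵀ Kᵀ) lists≤))

size≥1 : ∀ x → 1 ≤ size x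
size≥1 nil        = s≤s z≤n
size≥1 (cons _ _) = s≤s z≤n

theorem3p3 : ∃[ p ] (PolynomialTime p × IsApproximation 8 p)
theorem3p3 = program , polynomial (monomial-bound mainᴾ) , approximation
  where
  polynomial : ∃[ c ] ∃[ d ] (∀ N → 1 ≤ N → ⟦ mainᴾ ⟧ N ≤ c * N ^ d) → PolynomialTime program
  polynomial (c , d , h) = c , d , λ I → let (M , t , run , t≤ , _) = run-program I in
    encodeSolution M , t , run , ≤-trans t≤ (h (size (encodeInstance I)) (size≥1 (encodeInstance I)))

  approximation : IsApproximation 8 program
  approximation I = let (M , t , run , _ , feasible , best) = run-program I in
    M , t , run , feasible , λ _ optimal → best (proj₁ optimal)
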